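{- No model of $\mathrm{ZFU}_{\mathrm R}$ + Plenitude, equipped with its definable classes, has a parametrically definable map (from classes to objects) that fulfills Basic Law V.
   Context: The language of urelement set theory has $\in$ and a unary predicate $\mathscr{A}$ for urelements; a set is an object that is not a urelement. $\mathrm{ZFU}_{\mathrm R}$ has the axioms: urelements have no members; Extensionality for sets (sets with the same members are equal); Foundation; Pairing; Union; Powerset; Infinity; the Separation schema; the Replacement schema. The urelements may form a proper class. No form of the Axiom of Choice is assumed. Ordinals are transitive pure sets (sets with no urelements in their transitive closure) well-ordered by $\in$; a well-ordered cardinal is an initial ordinal. Plenitude is the axiom: for every well-ordered cardinal $\kappa$ there is a set of urelements of size $\kappa$ (i.e. in bijection with $\kappa$). Given a model $U$, its definable classes are the collections $\{x\in U: U\models\psi(x,z)\}$ with $\psi$ a first-order formula and $z\in U$ a parameter. "Equipped with definable classes" means that we consider the two-sorted structure whose objects are the elements of $U$ and whose classes are the definable classes. A map $X\mapsto\epsilon X$ from classes to objects is parametrically definable if its graph is defined over this structure by a second-order formula $\varphi(X,y,P)$ (quantifiers over objects and over definable classes allowed) with a definable class $P$ of $U$ as parameter. It fulfills Basic Law V if for all classes $X,Y$: $\epsilon X=\epsilon Y\leftrightarrow\forall x\,(x\in X\leftrightarrow x\in Y)$. -}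

module Defs where

open import Level using (Level) renaming (suc to lsuc)
open import Data.Nat using (ℕ; suc)
open import Data.Fin using (Fin)
open import Data.Vec using (Vec; []; _∷_; lookup)
open import Data.Product using (Σ; ∃; ∃!; _×_; _,_)
open import Data.Sum using (_⊎_)
open import Data.Empty.Polymorphic using (⊥)
open import Relation.Nullary using (¬_)
open import Relation.Binary.PropositionalEquality using (_≡_)
open import Function.Bundles using (_⇔_)

-- 𝒜 is the predicate of being a urelement.
record Structure (ℓ : Level) : Set (lsuc ℓ) where
  infix 4 _∈_
  field
    Carrier : Set ℓ
    _∈_     : Carrier → Carrier → Set ℓ
    𝒜       : Carrier → Set ℓ

infix  7 _≐_ _∈̇_
infixr 6 _∧̇_
infixr 5 _∨̇_
infixr 4 _⇒̇_

-- First-order formulas with n free variables (de Bruijn indices; a quantifier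
-- binds index zero).
data Formula (n : ℕ) : Set where
  _≐_ _∈̇_        : Fin n → Fin n → Formula n
  𝒜̇              : Fin n → Formula n
  ⊥̇              : Formula n
  _⇒̇_ _∧̇_ _∨̇_    : Formula n → Formula n → Formula n
  ∀̇_ ∃̇_          : Formula (suc n) → Formula n

-- Second-order formulas with m free class variables and n free object variables.
-- Equality of classes is not primitive: it abbreviates coextensiveness.
data Formula₂ (m n : ℕ) : Set where
  _≐_ _∈̇_        : Fin n → Fin n → Formula₂ m n
  𝒜̇              : Fin n → Formula₂ m n
  _∈̇ᶜ_           : Fin n → Fin m → Formula₂ m n
  ⊥̇              : Formula₂ m n
  _⇒̇_ _∧̇_ _∨̇_    : Formula₂ m n → Formula₂ m n → Formula₂ m n
  ∀̇_ ∃̇_          : Formula₂ m (suc n) → Formula₂ m n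
  ∀̇ᶜ_ ∃̇ᶜ_        : Formula₂ (suc m) n → Formula₂ m n

module _ {ℓ : Level} (U : Structure ℓ) where
  open Structure U

  infix 3 _⊨_ _,_⊨₂_
  infix 4 _∈ᶜ_

  _⊨_ : ∀ {n} → Vec Carrier n → Formula n → Set ℓ
  ρ ⊨ (i ≐ j)   = lookup ρ i ≡ lookup ρ j
  ρ ⊨ (i ∈̇ j)   = lookup ρ i ∈ lookup ρ j
  ρ ⊨ 𝒜̇ i       = 𝒜 (lookup ρ i)
  ρ ⊨ ⊥̇         = ⊥
  ρ ⊨ (φ ⇒̇ ψ)   = ρ ⊨ φ → ρ ⊨ ψ
  ρ ⊨ (φ ∧̇ ψ)   = (ρ ⊨ φ) × (ρ ⊨ ψ)
  ρ ⊨ (φ ∨̇ ψ)   = (ρ ⊨ φ) ⊎ (ρ ⊨ ψ)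
  ρ ⊨ (∀̇ φ)     = ∀ x → x ∷ ρ ⊨ φ
  ρ ⊨ (∃̇ φ)     = ∃ λ x → x ∷ ρ ⊨ φ

  -- A definable class { x : U ⊨ ψ(x , z) } is presented by a formula ψ and a
  -- parameter z. Identity of classes is coextensiveness, not _≡_ of presentations.
  record Class : Set ℓ where
    constructor ⟨_,_⟩
    field
      formula   : Formula 2
      parameter : Carrier

  _∈ᶜ_ : Carrier → Class → Set ℓ
  x ∈ᶜ ⟨ ψ , z ⟩ = x ∷ z ∷ [] ⊨ ψ

  _,_⊨₂_ : ∀ {m n} → Vec Class m → Vec Carrier n → Formula₂ m n → Set ℓ
  Γ , ρ ⊨₂ (i ≐ j)   = lookup ρ i ≡ lookup ρ j
  Γ , ρ ⊨₂ (i ∈̇ j)   = lookup ρ i ∈ lookup ρ j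
  Γ , ρ ⊨₂ 𝒜̇ i       = 𝒜 (lookup ρ i)
  Γ , ρ ⊨₂ (i ∈̇ᶜ k)  = lookup ρ i ∈ᶜ lookup Γ k
  Γ , ρ ⊨₂ ⊥̇         = ⊥
  Γ , ρ ⊨₂ (φ ⇒̇ ψ)   = Γ , ρ ⊨₂ φ → Γ , ρ ⊨₂ ψ
  Γ , ρ ⊨₂ (φ ∧̇ ψ)   = (Γ , ρ ⊨₂ φ) × (Γ , ρ ⊨₂ ψ)
  Γ , ρ ⊨₂ (φ ∨̇ ψ)   = (Γ , ρ ⊨₂ φ) ⊎ (Γ , ρ ⊨₂ ψ)
  Γ , ρ ⊨₂ (∀̇ φ)     = ∀ x → Γ , x ∷ ρ ⊨₂ φ
  Γ , ρ ⊨₂ (∃̇ φ)     = ∃ λ x → Γ , x ∷ ρ ⊨₂ φ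
  Γ , ρ ⊨₂ (∀̇ᶜ φ)    = ∀ X → X ∷ Γ , ρ ⊨₂ φ
  Γ , ρ ⊨₂ (∃̇ᶜ φ)    = ∃ λ X → X ∷ Γ , ρ ⊨₂ φ

  IsSet : Carrier → Set ℓ
  IsSet x = ¬ 𝒜 x

  _⊆_ : Carrier → Carrier → Set ℓ
  x ⊆ y = ∀ z → z ∈ x → z ∈ y

  -- No excluded middle is assumed of the metatheory: foundation, pairing and
  -- separation together already decide every ρ ⊨ φ (take an ∈-minimal element of
  -- { x ∈ {0 , 1} : x = 1 ∨ φ }), so the models obey classical first-order logic.
  record IsModelOfZFUR : Set ℓ where
    field
      urelements-empty : ∀ a x → 𝒜 a → ¬ (x ∈ a)
      extensionality   : ∀ x y → IsSet x → IsSet y →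
                         (∀ z → (z ∈ x) ⇔ (z ∈ y)) → x ≡ y
      foundation       : ∀ x → (∃ λ y → y ∈ x) →
                         ∃ λ y → y ∈ x × ¬ (∃ λ z → z ∈ x × z ∈ y)
      pairing          : ∀ x y → ∃ λ p → IsSet p ×
                         (∀ z → (z ∈ p) ⇔ (z ≡ x ⊎ z ≡ y))
      union            : ∀ x → ∃ λ u → IsSet u ×
                         (∀ z → (z ∈ u) ⇔ (∃ λ y → y ∈ x × z ∈ y))
      powerset         : ∀ x → ∃ λ p → IsSet p ×
                         (∀ z → (z ∈ p) ⇔ (IsSet z × z ⊆ x))
      infinity         : ∃ λ s → IsSet s ×
                         (∃ λ e → e ∈ s × IsSet e × (∀ z → ¬ (z ∈ e))) ×
                         (∀ x → x ∈ s → ∃ λ y → y ∈ s × IsSet y ×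
                           (∀ z → (z ∈ y) ⇔ (z ∈ x ⊎ z ≡ x)))
      separation       : ∀ {n} (φ : Formula (suc n)) (ρ : Vec Carrier n) →
                         ∀ x → ∃ λ s → IsSet s ×
                         (∀ z → (z ∈ s) ⇔ (z ∈ x × (z ∷ ρ ⊨ φ)))
      replacement      : ∀ {n} (φ : Formula (suc (suc n))) (ρ : Vec Carrier n) →
                         ∀ x →
                         (∀ u → u ∈ x → ∃! _≡_ λ v → u ∷ v ∷ ρ ⊨ φ) →
                         ∃ λ s → IsSet s ×
                         (∀ v → (v ∈ s) ⇔ (∃ λ u → u ∈ x × (u ∷ v ∷ ρ ⊨ φ)))

  IsTransitive : Carrier → Set ℓ
  IsTransitive x = ∀ y → y ∈ x → y ⊆ x

  IsTransitiveClosure : Carrier → Carrier → Set ℓ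
  IsTransitiveClosure t x =
    IsSet t × x ⊆ t × IsTransitive t ×
    (∀ s → IsSet s → x ⊆ s → IsTransitive s → t ⊆ s)

  IsPure : Carrier → Set ℓ
  IsPure x = IsSet x ×
    (∃ λ t → IsTransitiveClosure t x × (∀ y → y ∈ t → IsSet y))

  record IsWellOrderedBy∈ (x : Carrier) : Set ℓ where
    field
      irreflexive : ∀ u → u ∈ x → ¬ (u ∈ u)
      transitive  : ∀ u v w → u ∈ x → v ∈ x → w ∈ x → u ∈ v → v ∈ w → u ∈ w
      total       : ∀ u v → u ∈ x → v ∈ x → u ≡ v ⊎ (u ∈ v ⊎ v ∈ u)
      least       : ∀ s → s ⊆ x → (∃ λ u → u ∈ s) →
                    ∃ λ u → u ∈ s × (∀ v → v ∈ s → u ≡ v ⊎ u ∈ v)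

  IsOrdinal : Carrier → Set ℓ
  IsOrdinal α = IsTransitive α × IsPure α × IsWellOrderedBy∈ α

  IsUnorderedPair : Carrier → Carrier → Carrier → Set ℓ
  IsUnorderedPair p a b = ∀ z → (z ∈ p) ⇔ (z ≡ a ⊎ z ≡ b)

  -- Kuratowski pairs: p = {{a , a} , {a , b}}.
  IsOrderedPair : Carrier → Carrier → Carrier → Set ℓ
  IsOrderedPair p a b =
    ∀ z → (z ∈ p) ⇔ (IsUnorderedPair z a a ⊎ IsUnorderedPair z a b)

  Relates : Carrier → Carrier → Carrier → Set ℓ
  Relates f a b = ∃ λ p → p ∈ f × IsOrderedPair p a b

  record IsBijection (f x y : Carrier) : Set ℓ where
    field
      isSet      : IsSet f
      ⊆-product  : ∀ p → p ∈ f →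
                   ∃ λ a → ∃ λ b → a ∈ x × b ∈ y × IsOrderedPair p a b
      functional : ∀ a → a ∈ x → ∃! _≡_ λ b → Relates f a b
      bijective  : ∀ b → b ∈ y → ∃! _≡_ λ a → Relates f a b

  Equinumerous : Carrier → Carrier → Set ℓ
  Equinumerous x y = ∃ λ f → IsBijection f x y

  IsInitialOrdinal : Carrier → Set ℓ
  IsInitialOrdinal κ = IsOrdinal κ × (∀ α → α ∈ κ → ¬ Equinumerous α κ)

  Plenitude : Set ℓ
  Plenitude = ∀ κ → IsInitialOrdinal κ →
    ∃ λ A → IsSet A × (∀ a → a ∈ A → 𝒜 a) × Equinumerous A κ

  -- In φ(X , y , P) class index 0 is X, class index 1 is P, object index 0 is y.
  ParametricallyDefinable : (Class → Carrier) → Set ℓ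
  ParametricallyDefinable ε =
    Σ (Formula₂ 2 1) λ φ → ∃ λ P →
    ∀ X y → (ε X ≡ y) ⇔ (X ∷ P ∷ [] , y ∷ [] ⊨₂ φ)

  -- The right-to-left direction makes ε independent of how a class is presented.
  BasicLawV : (Class → Carrier) → Set ℓ
  BasicLawV ε = ∀ X Y → (ε X ≡ ε Y) ⇔ (∀ x → (x ∈ᶜ X) ⇔ (x ∈ᶜ Y))

{-# OPTIONS --safe #-}
module Submission where

-- An involution of the urelements that is coded by a set extends by ∈-recursion to an
-- automorphism of U, and automorphisms act on definable classes.  If p is the parameter of P
-- and T ∋ p is transitive, an automorphism τ fixing all urelements of T fixes P, so
-- ε(τX) = τ(εX), and by Basic Law V τ fixes εX iff it fixes X.
-- Closing T under singletons, Plenitude for the least ordinal κ that is not an image of a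
-- subset of T gives a set W of urelements outside T that is not such an image either.
-- Let X = {D : W ∖ D is an image of a subset of T}.  Transposing a urelement outside T with
-- a fresh one fixes X, hence εX; as the fresh one ranges over a proper class, all urelements
-- in the transitive closure of εX lie in T.  So swapping W with a disjoint copy W′ outside T
-- fixes εX, hence X, although W ∈ X and W′ ∉ X.

open import Level using (Level)
open import Defs
open import Data.Nat using (ℕ; suc)
open import Data.Fin using (Fin; zero; suc)
open import Data.Vec using (Vec; []; _∷_; lookup; map)
open import Data.Vec.Properties using (lookup-map)
open import Data.Product using (Σ; ∃; _×_; _,_; proj₁; proj₂)
open import Data.Sum using (_⊎_; inj₁; inj₂; [_,_]′)
open import Data.Empty.Polymorphic using (⊥; ⊥-elim)
open import Data.Empty using () renaming (⊥-elim to ⊥₀-elim)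
open import Relation.Nullary using (¬_)
open import Relation.Binary.PropositionalEquality using (_≡_; refl; sym; trans; subst; cong)
open import Function.Bundles using (_⇔_; mk⇔; Equivalence)

-- Russell's paradox does not settle the matter: the class of all εX with εX ∉ X is described by a
-- quantifier over classes, so it need not be a definable class. The contradiction has to come from
-- symmetry, and `X` must ignore a change at one urelement while noticing the exchange of all of W;
-- hence it is defined up to a remainder. The set B of urelements given by Plenitude may overlap T,
-- whose elements must not move. B is taken too large for T so that enough of it is left outside.
-- Closure of T under singletons replaces cardinal arithmetic that would use Choice: t ↦ {t} maps T
-- injectively into itself and misses every urelement and ∅. It leaves room for one more element,
-- and lets a set of urelements lying partly in T and partly indexed by T be mapped injectively into
-- T. Case distinctions are available for formulas of the language only, while automorphisms are
-- maps of the metatheory. Properties to be decided, or proved by ∈-induction, are therefore written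
-- as formulas.

private
  variable
    n m : ℕ

-- First-order formulas: abbreviations and renaming of variables.

pattern v0 = zero
pattern v1 = suc v0
pattern v2 = suc v1
pattern v3 = suc v2
pattern v4 = suc v3
pattern v5 = suc v4

infixr 3 _⇔̇_
infix 8 ¬̇_

¬̇_ : Formula n → Formula n
¬̇ φ = φ ⇒̇ ⊥̇

_⇔̇_ : Formula n → Formula n → Formula n
φ ⇔̇ ψ = (φ ⇒̇ ψ) ∧̇ (ψ ⇒̇ φ)

∀∈ ∃∈ : Fin n → Formula (suc n) → Formula n
∀∈ i φ = ∀̇ (v0 ∈̇ suc i ⇒̇ φ)
∃∈ i φ = ∃̇ (v0 ∈̇ suc i ∧̇ φ)

lift : (Fin n → Fin m) → Fin (suc n) → Fin (suc m)
lift θ zero    = zero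
lift θ (suc i) = suc (θ i)

rename : (Fin n → Fin m) → Formula n → Formula m
rename θ (i ≐ j)  = θ i ≐ θ j
rename θ (i ∈̇ j)  = θ i ∈̇ θ j
rename θ (𝒜̇ i)    = 𝒜̇ (θ i)
rename θ ⊥̇        = ⊥̇
rename θ (φ ⇒̇ ψ)  = rename θ φ ⇒̇ rename θ ψ
rename θ (φ ∧̇ ψ)  = rename θ φ ∧̇ rename θ ψ
rename θ (φ ∨̇ ψ)  = rename θ φ ∨̇ rename θ ψ
rename θ (∀̇ φ)    = ∀̇ rename (lift θ) φ
rename θ (∃̇ φ)    = ∃̇ rename (lift θ) φ

swapVar : Fin (suc (suc n)) → Fin (suc (suc n))
swapVar v0            = v1
swapVar v1            = v0
swapVar (suc (suc i)) = suc (suc i)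

swap : Formula (suc (suc n)) → Formula (suc (suc n))
swap = rename swapVar

-- Moves a formula about a, b, ρ into the context b, a, p, x, y, ρ that arises in `relation`.
pairVar : Fin (suc (suc n)) → Fin (suc (suc (suc (suc (suc n)))))
pairVar v0            = v1
pairVar v1            = v0
pairVar (suc (suc i)) = suc (suc (suc (suc (suc i))))

setF : Fin n → Formula n
setF i = ¬̇ 𝒜̇ i

transF : Fin n → Formula n
transF x = ∀∈ x (∀∈ v0 (v0 ∈̇ suc (suc x)))

unorderedPairF orderedPairF relF : Fin n → Fin n → Fin n → Formula n
unorderedPairF p a b = ∀̇ (v0 ∈̇ suc p ⇔̇ (v0 ≐ suc a ∨̇ v0 ≐ suc b))
orderedPairF p a b =
  ∀̇ (v0 ∈̇ suc p ⇔̇ (unorderedPairF v0 (suc a) (suc a) ∨̇ unorderedPairF v0 (suc a) (suc b)))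
relF f a b = ∃∈ f (orderedPairF v0 (suc a) (suc b))

ordF : Fin n → Formula n
ordF x = setF x ∧̇ transF x ∧̇ ∀∈ x (setF v0 ∧̇ transF v0)

comparableF : Fin n → Fin n → Formula n
comparableF x y = x ∈̇ y ∨̇ x ≐ y ∨̇ y ∈̇ x

injectiveF : Fin n → Formula n
injectiveF f = ∀̇ ∀̇ ∀̇ (relF (suc (suc (suc f))) v2 v0 ⇒̇ relF (suc (suc (suc f))) v1 v0 ⇒̇ v2 ≐ v1)

segmentF : Fin n → Fin n → Fin n → Fin n → Formula n
segmentF T f β c = setF c ∧̇
  ∀̇ (v0 ∈̇ suc c ⇔̇ (v0 ∈̇ suc T ∧̇ ∃∈ (suc β) (relF (suc (suc f)) v0 v1)))

candidateF : Fin n → Fin n → Fin n → Fin n → Formula n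
candidateF B T r y = y ∈̇ B ∧̇ ¬̇ (y ∈̇ T) ∧̇ ¬̇ (y ∈̇ r)

coversF : Fin n → Fin n → Fin n → Formula n
coversF W D T = ∃̇ (∀∈ (suc W) (v0 ∈̇ suc (suc D) ∨̇ ∃∈ (suc (suc T)) (relF v2 v1 v0)) ∧̇ injectiveF v0)

-- Elementary set theory and classical logic inside a model.

module Model {ℓ : Level} (U : Structure ℓ) (M : IsModelOfZFUR U) where
  open Structure U
  private module Ax = IsModelOfZFUR M

  infix 3 _⊩_
  infix 2 _↔_

  -- Satisfaction unfolds definitionally, provided that biconditionals are pairs
  -- and falsity lives at level ℓ.
  _⊩_ : Vec Carrier n → Formula n → Set ℓ
  _⊩_ = _⊨_ U

  _↔_ : Set ℓ → Set ℓ → Set ℓ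
  A ↔ B = (A → B) × (B → A)

  from⇔ : {A B : Set ℓ} → A ⇔ B → A ↔ B
  from⇔ e = Equivalence.to e , Equivalence.from e

  Neg : Set ℓ → Set ℓ
  Neg A = A → ⊥ {ℓ}

  from¬ : {A : Set ℓ} → ¬ A → Neg A
  from¬ ¬a a = ⊥₀-elim (¬a a)

  to¬ : {A : Set ℓ} → Neg A → ¬ A
  to¬ ¬a a = ⊥-elim (¬a a)

  isSet : Carrier → Set ℓ
  isSet x = Neg (𝒜 x)

  Sub : Carrier → Carrier → Set ℓ
  Sub x y = ∀ z → z ∈ x → z ∈ y

  Trans : Carrier → Set ℓ
  Trans x = ∀ y → y ∈ x → Sub y x

  UPair OPair Rel : Carrier → Carrier → Carrier → Set ℓ
  UPair p a b = ∀ z → z ∈ p ↔ (z ≡ a ⊎ z ≡ b)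
  OPair p a b = ∀ z → z ∈ p ↔ (UPair z a a ⊎ UPair z a b)
  Rel f a b = ∃ λ p → p ∈ f × OPair p a b

  opaque
    rename-⊩ : (φ : Formula n) (θ : Fin n → Fin m) {ρ : Vec Carrier m} {ρ′ : Vec Carrier n} →
               (∀ i → lookup ρ (θ i) ≡ lookup ρ′ i) → (ρ ⊩ rename θ φ) ↔ (ρ′ ⊩ φ)
    rename-⊩ (i ≐ j) θ eq rewrite eq i | eq j = (λ x → x) , (λ x → x)
    rename-⊩ (i ∈̇ j) θ eq rewrite eq i | eq j = (λ x → x) , (λ x → x)
    rename-⊩ (𝒜̇ i) θ eq rewrite eq i = (λ x → x) , (λ x → x)
    rename-⊩ ⊥̇ θ eq = (λ x → x) , (λ x → x)
    rename-⊩ (φ ⇒̇ ψ) θ eq with rename-⊩ φ θ eq | rename-⊩ ψ θ eq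
    ... | (a , b) | (c , d) = (λ h x → c (h (b x))) , (λ h x → d (h (a x)))
    rename-⊩ (φ ∧̇ ψ) θ eq with rename-⊩ φ θ eq | rename-⊩ ψ θ eq
    ... | (a , b) | (c , d) = (λ (x , y) → a x , c y) , (λ (x , y) → b x , d y)
    rename-⊩ (φ ∨̇ ψ) θ eq with rename-⊩ φ θ eq | rename-⊩ ψ θ eq
    ... | (a , b) | (c , d) = [ (λ x → inj₁ (a x)) , (λ y → inj₂ (c y)) ]′
                            , [ (λ x → inj₁ (b x)) , (λ y → inj₂ (d y)) ]′
    rename-⊩ (∀̇ φ) θ {ρ} {ρ′} eq =
        (λ h x → proj₁ (rename-⊩ φ (lift θ) (lift-eq x)) (h x))
      , (λ h x → proj₂ (rename-⊩ φ (lift θ) (lift-eq x)) (h x))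
      where
      lift-eq : ∀ x i → lookup (x ∷ ρ) (lift θ i) ≡ lookup (x ∷ ρ′) i
      lift-eq x zero    = refl
      lift-eq x (suc i) = eq i
    rename-⊩ (∃̇ φ) θ {ρ} {ρ′} eq =
        (λ (x , h) → x , proj₁ (rename-⊩ φ (lift θ) (lift-eq x)) h)
      , (λ (x , h) → x , proj₂ (rename-⊩ φ (lift θ) (lift-eq x)) h)
      where
      lift-eq : ∀ x i → lookup (x ∷ ρ) (lift θ i) ≡ lookup (x ∷ ρ′) i
      lift-eq x zero    = refl
      lift-eq x (suc i) = eq i

  swap-⊩ : (φ : Formula (suc (suc n))) {x y : Carrier} {ρ : Vec Carrier n} →
           (y ∷ x ∷ ρ ⊩ swap φ) ↔ (x ∷ y ∷ ρ ⊩ φ)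
  swap-⊩ φ = rename-⊩ φ swapVar λ { v0 → refl ; v1 → refl ; (suc (suc i)) → refl }

  inhabited⇒set : ∀ {x y} → y ∈ x → isSet x
  inhabited⇒set y∈x a = from¬ (Ax.urelements-empty _ _ a) y∈x

  ext : ∀ {x y} → isSet x → isSet y → Sub x y → Sub y x → x ≡ y
  ext sx sy f g = Ax.extensionality _ _ (to¬ sx) (to¬ sy) λ z → mk⇔ (f z) (g z)

  foundation : ∀ {x y} → y ∈ x → ∃ λ z → z ∈ x × (∀ w → w ∈ x → w ∈ z → ⊥ {ℓ})
  foundation {x} y∈x with Ax.foundation x (_ , y∈x)
  ... | z , z∈x , h = z , z∈x , λ w w∈x w∈z → from¬ h (w , w∈x , w∈z)

  opaque
    upair : ∀ a b → ∃ λ p → UPair p a b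
    upair a b with Ax.pairing a b
    ... | p , _ , h = p , λ z → from⇔ (h z)

  opaque
    union : ∀ x → ∃ λ u → isSet u × (∀ z → z ∈ u ↔ ∃ λ y → y ∈ x × z ∈ y)
    union x with Ax.union x
    ... | u , s , h = u , from¬ s , λ z → from⇔ (h z)

  opaque
    power : ∀ x → ∃ λ u → ∀ z → z ∈ u ↔ (isSet z × Sub z x)
    power x with Ax.powerset x
    ... | u , s , h = u , λ z →
          (λ e → let (a , b) = Equivalence.to (h z) e in from¬ a , b)
        , (λ (a , b) → Equivalence.from (h z) (to¬ a , b))

  opaque
    sep : (φ : Formula (suc n)) (ρ : Vec Carrier n) → ∀ x →
          ∃ λ s → isSet s × (∀ z → z ∈ s ↔ (z ∈ x × (z ∷ ρ ⊩ φ)))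
    sep φ ρ x with Ax.separation φ ρ x
    ... | u , s , h = u , from¬ s , λ z → from⇔ (h z)

  opaque
    empty : ∃ λ e → ∀ z → Neg (z ∈ e)
    empty with Ax.infinity
    ... | _ , _ , (e , _ , _ , h) , _ = e , λ z → from¬ (h z)

  ∅ : Carrier
  ∅ = proj₁ empty

  ∉∅ : ∀ {z} → Neg (z ∈ ∅)
  ∉∅ = proj₂ empty _

  opaque
    -- The source of all classical reasoning below: a property can be decided once it is written as
    -- a formula.
    dec : (φ : Formula n) (ρ : Vec Carrier n) → (ρ ⊩ φ) ⊎ Neg (ρ ⊩ φ)
    dec φ ρ with upair ∅ ∅
    ... | one , one-pair with upair ∅ one
    ... | two , two-pair
      with sep (v0 ≐ v1 ∨̇ rename (λ i → suc (suc i)) φ) (one ∷ ρ) two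
    ... | s , _ , s-mem
      with foundation {s} (proj₂ (s-mem one) (proj₂ (two-pair one) (inj₂ refl) , inj₁ refl))
    ... | y , y∈s , y-min with proj₁ (s-mem y) y∈s
    ... | y∈two , inj₂ h = inj₁ (proj₁ (rename-⊩ φ _ λ i → refl) h)
    ... | y∈two , inj₁ refl = inj₂ λ h → y-min ∅
            (proj₂ (s-mem ∅) (proj₂ (two-pair ∅) (inj₁ refl) , inj₂ (proj₂ (rename-⊩ φ _ λ i → refl) h)))
            (proj₂ (one-pair ∅) (inj₁ refl))

  dec-∈ : ∀ x y → (x ∈ y) ⊎ Neg (x ∈ y)
  dec-∈ x y = dec (v0 ∈̇ v1) (x ∷ y ∷ [])

  dec-≡ : ∀ x y → (x ≡ y) ⊎ Neg (x ≡ y)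
  dec-≡ x y = dec (v0 ≐ v1) (x ∷ y ∷ [])

  dec-𝒜 : ∀ x → 𝒜 x ⊎ isSet x
  dec-𝒜 x = dec (𝒜̇ v0) (x ∷ [])

  opaque
    -- The axiom asks for a value at every element of the set. Separating out the elements that have
    -- a value removes this demand.
    replacement : (φ : Formula (suc (suc n))) (ρ : Vec Carrier n) → ∀ x →
                  (∀ u v v′ → u ∈ x → u ∷ v ∷ ρ ⊩ φ → u ∷ v′ ∷ ρ ⊩ φ → v ≡ v′) →
                  ∃ λ s → isSet s × (∀ v → v ∈ s ↔ ∃ λ u → u ∈ x × (u ∷ v ∷ ρ ⊩ φ))
    replacement φ ρ x uniq with sep (∃̇ swap φ) ρ x
    ... | d , _ , d-mem
      with Ax.replacement φ ρ d (λ u u∈d →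
             let (u∈x , v , h) = proj₁ (d-mem u) u∈d
                 h′ = proj₁ (swap-⊩ φ) h
             in v , h′ , λ k → uniq u _ _ u∈x h′ k)
    ... | s , s-set , s-mem = s , from¬ s-set , λ v →
          (λ v∈s → let (u , u∈d , h) = Equivalence.to (s-mem v) v∈s
                   in u , proj₁ (proj₁ (d-mem u) u∈d) , h)
        , (λ (u , u∈x , h) → Equivalence.from (s-mem v)
             (u , proj₂ (d-mem u) (u∈x , v , proj₂ (swap-⊩ φ) h) , h))

  opaque
    -- Foundation is applied to the set of counterexamples in `t`; transitivity of `t` keeps the
    -- members of a minimal one inside `t`, and `dec` turns the absence of a counterexample into
    -- truth.
    induction : (φ : Formula (suc n)) (ρ : Vec Carrier n) → ∀ t → Trans t →
                (∀ x → x ∈ t → (∀ y → y ∈ x → y ∷ ρ ⊩ φ) → x ∷ ρ ⊩ φ) →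
                ∀ x → x ∈ t → x ∷ ρ ⊩ φ
    induction φ ρ t t-trans step x x∈t with dec φ (x ∷ ρ)
    ... | inj₁ h = h
    ... | inj₂ ¬h with sep (¬̇ φ) ρ t
    ... | s , _ , s-mem with foundation (proj₂ (s-mem x) (x∈t , ¬h))
    ... | y , y∈s , y-min with proj₁ (s-mem y) y∈s
    ... | y∈t , ¬hy = ⊥-elim (¬hy (step y y∈t below))
      where
      below : ∀ z → z ∈ y → z ∷ ρ ⊩ φ
      below z z∈y with dec φ (z ∷ ρ)
      ... | inj₁ h = h
      ... | inj₂ ¬hz = ⊥-elim (y-min z (proj₂ (s-mem z) (t-trans y y∈t z z∈y , ¬hz)) z∈y)

  ∈-irrefl : ∀ {x} → Neg (x ∈ x)
  ∈-irrefl {x} x∈x with upair x x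
  ... | p , p-pair with foundation (proj₂ (p-pair x) (inj₁ refl))
  ... | y , y∈p , y-min with proj₁ (p-pair y) y∈p
  ... | inj₁ refl = y-min y y∈p x∈x
  ... | inj₂ refl = y-min y y∈p x∈x

  opaque
    binaryUnion : ∀ x y → ∃ λ u → isSet u × (∀ z → z ∈ u ↔ (z ∈ x ⊎ z ∈ y))
    binaryUnion x y with upair x y
    ... | p , p-pair with union p
    ... | u , u-set , u-mem = u , u-set , λ z → to z , from z
      where
      to : ∀ z → z ∈ u → z ∈ x ⊎ z ∈ y
      to z z∈u with proj₁ (u-mem z) z∈u
      ... | w , w∈p , z∈w with proj₁ (p-pair w) w∈p
      ... | inj₁ refl = inj₁ z∈w
      ... | inj₂ refl = inj₂ z∈w
      from : ∀ z → z ∈ x ⊎ z ∈ y → z ∈ u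
      from z (inj₁ h) = proj₂ (u-mem z) (x , proj₂ (p-pair x) (inj₁ refl) , h)
      from z (inj₂ h) = proj₂ (u-mem z) (y , proj₂ (p-pair y) (inj₂ refl) , h)

  upair-unique : ∀ {p q a b} → UPair p a b → UPair q a b → p ≡ q
  upair-unique {p} {q} {a} hp hq =
    ext (inhabited⇒set (proj₂ (hp a) (inj₁ refl))) (inhabited⇒set (proj₂ (hq a) (inj₁ refl)))
        (λ z z∈p → proj₂ (hq z) (proj₁ (hp z) z∈p))
        (λ z z∈q → proj₂ (hp z) (proj₁ (hq z) z∈q))

  singleton-injective : ∀ {p a b} → UPair p a a → UPair p b b → a ≡ b
  singleton-injective {p} {a} ha hb with proj₁ (hb a) (proj₂ (ha a) (inj₁ refl))
  ... | inj₁ e = e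
  ... | inj₂ e = e

  opaque
    opair : ∀ a b → ∃ λ p → OPair p a b
    opair a b with upair a a | upair a b
    ... | s , s-pair | d , d-pair with upair s d
    ... | p , p-pair = p , λ z → to z , from z
      where
      to : ∀ z → z ∈ p → UPair z a a ⊎ UPair z a b
      to z z∈p with proj₁ (p-pair z) z∈p
      ... | inj₁ refl = inj₁ s-pair
      ... | inj₂ refl = inj₂ d-pair
      from : ∀ z → UPair z a a ⊎ UPair z a b → z ∈ p
      from z (inj₁ h) = proj₂ (p-pair z) (inj₁ (upair-unique h s-pair))
      from z (inj₂ h) = proj₂ (p-pair z) (inj₂ (upair-unique h d-pair))

  opair-injective : ∀ {p a b c d} → OPair p a b → OPair p c d → a ≡ c × b ≡ d
  opair-injective {p} {a} {b} {c} {d} hab hcd = a≡c , b≡d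
    where
    first : ∀ {a b c d} → OPair p a b → OPair p c d → c ≡ a
    first {a} {b} {c} {d} hab hcd with upair a a
    ... | s , s-pair with proj₁ (hcd s) (proj₂ (hab s) (inj₁ s-pair))
    ... | inj₁ h = [ (λ e → e) , (λ e → e) ]′ (proj₁ (s-pair c) (proj₂ (h c) (inj₁ refl)))
    ... | inj₂ h = [ (λ e → e) , (λ e → e) ]′ (proj₁ (s-pair c) (proj₂ (h c) (inj₁ refl)))
    second : ∀ {a b c d} → OPair p a b → OPair p c d → b ≡ c ⊎ b ≡ d
    second {a} {b} {c} {d} hab hcd with upair a b
    ... | s , s-pair with proj₁ (hcd s) (proj₂ (hab s) (inj₂ s-pair))
    ... | inj₁ h = [ inj₁ , inj₁ ]′ (proj₁ (h b) (proj₂ (s-pair b) (inj₂ refl)))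
    ... | inj₂ h = proj₁ (h b) (proj₂ (s-pair b) (inj₂ refl))
    a≡c : a ≡ c
    a≡c = first hcd hab
    b≡d : b ≡ d
    b≡d with second hab hcd | second hcd hab
    ... | inj₂ e | _ = e
    ... | inj₁ e | inj₂ e′ = sym e′
    ... | inj₁ e | inj₁ e′ = trans e (trans (sym a≡c) (sym e′))

  opaque
    -- Every Kuratowski pair of elements of x ∪ y lies in the double power set of x ∪ y, so
    -- Separation applies there.
    relation : (φ : Formula (suc (suc n))) (ρ : Vec Carrier n) → ∀ x y →
               ∃ λ g → ∀ a b → Rel g a b ↔ (a ∈ x × b ∈ y × (a ∷ b ∷ ρ ⊩ φ))
    relation φ ρ x y with binaryUnion x y
    ... | xy , _ , xy-mem with power xy
    ... | P₁ , P₁-mem with power P₁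
    ... | P₂ , P₂-mem
      with sep (∃̇ ∃̇ (v1 ∈̇ v3 ∧̇ v0 ∈̇ v4 ∧̇ orderedPairF v2 v1 v0 ∧̇ rename pairVar φ)) (x ∷ y ∷ ρ) P₂
    ... | g , g-set , g-mem = g , λ a b → to a b , from a b
      where
      ren : ∀ {a b p} → (b ∷ a ∷ p ∷ x ∷ y ∷ ρ ⊩ rename pairVar φ) ↔ (a ∷ b ∷ ρ ⊩ φ)
      ren = rename-⊩ φ pairVar λ { v0 → refl ; v1 → refl ; (suc (suc i)) → refl }
      to : ∀ a b → Rel g a b → a ∈ x × b ∈ y × (a ∷ b ∷ ρ ⊩ φ)
      to a b (p , p∈g , hp) with proj₁ (g-mem p) p∈g
      ... | _ , a′ , b′ , a′∈x , b′∈y , hp′ , h with opair-injective hp hp′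
      ... | refl , refl = a′∈x , b′∈y , proj₁ ren h
      from : ∀ a b → a ∈ x × b ∈ y × (a ∷ b ∷ ρ ⊩ φ) → Rel g a b
      from a b (a∈x , b∈y , h) with opair a b
      ... | p , hp = p , proj₂ (g-mem p) (p∈P₂ , a , b , a∈x , b∈y , hp , proj₂ ren h) , hp
        where
        sub : ∀ {z c} → c ∈ xy → UPair z a c → isSet z × Sub z xy
        sub c∈xy hz = inhabited⇒set (proj₂ (hz a) (inj₁ refl)) , λ w w∈z →
          [ (λ { refl → proj₂ (xy-mem a) (inj₁ a∈x) }) , (λ { refl → c∈xy }) ]′ (proj₁ (hz w) w∈z)
        p∈P₂ : p ∈ P₂
        p∈P₂ = proj₂ (P₂-mem p)
          ( inhabited⇒set (proj₂ (hp _) (inj₁ (proj₂ (upair a a))))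
          , λ z z∈p → proj₂ (P₁-mem z)
              ([ sub (proj₂ (xy-mem a) (inj₁ a∈x)) , sub (proj₂ (xy-mem b) (inj₂ b∈y)) ]′
                 (proj₁ (hp z) z∈p)) )

  opaque
    addPair : ∀ g u y → ∃ λ g′ → ∀ a b → Rel g′ a b ↔ (Rel g a b ⊎ (a ≡ u × b ≡ y))
    addPair g u y with opair u y
    ... | p , hp with upair p p
    ... | s , s-pair with binaryUnion g s
    ... | g′ , _ , g′-mem = g′ , λ a b → to a b , from a b
      where
      to : ∀ a b → Rel g′ a b → Rel g a b ⊎ (a ≡ u × b ≡ y)
      to a b (q , q∈g′ , hq) with proj₁ (g′-mem q) q∈g′
      ... | inj₁ q∈g = inj₁ (q , q∈g , hq)
      ... | inj₂ q∈s with proj₁ (s-pair q) q∈s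
      ... | inj₁ refl = inj₂ (opair-injective hq hp)
      ... | inj₂ refl = inj₂ (opair-injective hq hp)
      from : ∀ a b → Rel g a b ⊎ (a ≡ u × b ≡ y) → Rel g′ a b
      from a b (inj₁ (q , q∈g , hq)) = q , proj₂ (g′-mem q) (inj₁ q∈g) , hq
      from a b (inj₂ (refl , refl)) = p , proj₂ (g′-mem p) (inj₂ (proj₂ (s-pair p) (inj₁ refl))) , hp

  -- Recursion along ∈.

  -- Recursion h(u) = F(u , {h(v) : v ∈ u}).  An attempt is a set of pairs (u , y) each of
  -- which is justified by other pairs of the set; its domain need not be transitive.
  module Recursion {n : ℕ} (ρ : Vec Carrier n) (Φ : Formula (suc (suc (suc n)))) where

    F : Carrier → Carrier → Carrier → Set ℓ
    F u r y = u ∷ r ∷ y ∷ ρ ⊩ Φ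

    Attempt : Carrier → Set ℓ
    Attempt g = ∀ u y → Rel g u y → ∃ λ r → isSet r ×
      (∀ z → z ∈ r → ∃ λ v → v ∈ u × Rel g v z) ×
      (∀ v → v ∈ u → ∃ λ z → z ∈ r × Rel g v z) × F u r y

    -- Reads `Φ` at u′, r, y′ in the context r, y′, u′, g, u, y, ρ that arises inside `HF`.
    θ : Fin (suc (suc (suc n))) → Fin (suc (suc (suc (suc (suc (suc n))))))
    θ v0 = v2
    θ v1 = v0
    θ v2 = v1
    θ (suc (suc (suc i))) = suc (suc (suc (suc (suc (suc i)))))

    opaque
      -- Some attempt contains (u , y). As a first-order formula, the function being defined can
      -- itself enter Replacement, `relation` and `induction`.
      HF : Formula (suc (suc n))
      HF = ∃̇ ((∀̇ ∀̇ (relF v2 v1 v0 ⇒̇ ∃̇ (setF v0 ∧̇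
                  ∀∈ v0 (∃∈ v3 (relF v5 v0 v1)) ∧̇
                  ∀∈ v2 (∃∈ v1 (relF v5 v1 v0)) ∧̇ rename θ Φ)))
              ∧̇ relF v0 v1 v2)

    H : Carrier → Carrier → Set ℓ
    H u y = u ∷ y ∷ ρ ⊩ HF

    private
      ren : ∀ {r y′ u′ g u y} →
            (r ∷ y′ ∷ u′ ∷ g ∷ u ∷ y ∷ ρ ⊩ rename θ Φ) ↔ F u′ r y′
      ren = rename-⊩ Φ θ λ { v0 → refl ; v1 → refl ; v2 → refl ; (suc (suc (suc i))) → refl }

    opaque
      unfolding HF
      toH : ∀ {u y} g → Attempt g → Rel g u y → H u y
      toH g att h = g , (λ u′ y′ k → let (r , a , b , c , d) = att u′ y′ k
                                     in r , a , b , c , proj₂ ren d) , h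

      fromH : ∀ {u y} → H u y → ∃ λ g → Attempt g × Rel g u y
      fromH (g , att , h) = g , (λ u′ y′ k → let (r , a , b , c , d) = att u′ y′ k
                                             in r , a , b , c , proj₁ ren d) , h

    unfold : ∀ {u y} → H u y → ∃ λ r → isSet r ×
      (∀ z → z ∈ r → ∃ λ v → v ∈ u × H v z) ×
      (∀ v → v ∈ u → ∃ λ z → z ∈ r × H v z) × F u r y
    unfold {u} {y} h with fromH h
    ... | g , att , k with att u y k
    ... | r , r-set , a , b , f =
          r , r-set
        , (λ z z∈r → let (v , v∈u , l) = a z z∈r in v , v∈u , toH g att l)
        , (λ v v∈u → let (z , z∈r , l) = b v v∈u in z , z∈r , toH g att l)
        , f

    private
      subset : ∀ {u g g′ r r′} →
        (∀ v → v ∈ u → ∀ z z′ → Rel g v z → Rel g′ v z′ → z ≡ z′) →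
        (∀ z → z ∈ r → ∃ λ v → v ∈ u × Rel g v z) →
        (∀ v → v ∈ u → ∃ λ z → z ∈ r′ × Rel g′ v z) → Sub r r′
      subset ih a b z z∈r with a z z∈r
      ... | v , v∈u , k with b v v∈u
      ... | z′ , z′∈r′ , k′ with ih v v∈u z z′ k k′
      ... | refl = z′∈r′

    module Solution
      (F-total  : ∀ u r → isSet r → ∃ λ y → F u r y)
      (F-unique : ∀ u r y y′ → F u r y → F u r y′ → y ≡ y′)
      where

      opaque
        -- Two attempts agree on the members of u by induction, so they justify their values at u
        -- from the same set r, and `F-unique` applies.
        unique : ∀ {t} → Trans t → ∀ {u y y′} → u ∈ t → H u y → H u y′ → y ≡ y′
        unique {t} t-trans {u} {y} {y′} u∈t h h′ with fromH h | fromH h′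
        ... | g , att , k | g′ , att′ , k′ =
          induction (∀̇ ∀̇ (relF v3 v2 v1 ⇒̇ relF v4 v2 v0 ⇒̇ v1 ≐ v0)) (g ∷ g′ ∷ []) t t-trans
            step u u∈t y y′ k k′
          where
          step : ∀ u → u ∈ t → (∀ v → v ∈ u → ∀ z z′ → Rel g v z → Rel g′ v z′ → z ≡ z′) →
                 ∀ y y′ → Rel g u y → Rel g′ u y′ → y ≡ y′
          step u _ ih y y′ k k′ with att u y k | att′ u y′ k′
          ... | r , r-set , a , b , f | r′ , r′-set , a′ , b′ , f′
            with ext r-set r′-set (subset ih a b′)
                   (subset (λ v v∈u z z′ l l′ → sym (ih v v∈u z′ z l′ l)) a′ b)
          ... | refl = F-unique u r y y′ f f′

      opaque
        -- No attempts have to be selected: the graph of `H` on `t` is a set by Replacement and is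
        -- itself an attempt, by `unfold`. Adding the pair (u , y) keeps it one.
        total : ∀ {t} → Trans t → ∀ {u} → u ∈ t → ∃ λ y → H u y
        total {t} t-trans {u} u∈t =
          let (y , h) = induction (∃̇ swap HF) ρ t t-trans step u u∈t in y , proj₁ (swap-⊩ HF) h
          where
          step : ∀ u → u ∈ t → (∀ v → v ∈ u → ∃ λ z → z ∷ v ∷ ρ ⊩ swap HF) →
                 ∃ λ y → y ∷ u ∷ ρ ⊩ swap HF
          step u u∈t ih
            with replacement HF ρ u (λ v z z′ v∈u → unique t-trans (t-trans u u∈t v v∈u))
               | replacement HF ρ t (λ v z z′ v∈t → unique t-trans v∈t)
          ... | r , r-set , r-mem | Z , _ , Z-mem with F-total u r r-set | relation HF ρ t Z
          ... | y , f | G , G-rel with addPair G u y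
          ... | g , g-rel = y , proj₂ (swap-⊩ HF) (toH g att (proj₂ (g-rel u y) (inj₂ (refl , refl))))
            where
            H⇒g : ∀ {v z} → v ∈ t → H v z → Rel g v z
            H⇒g v∈t h = proj₂ (g-rel _ _) (inj₁ (proj₂ (G-rel _ _)
                          (v∈t , proj₂ (Z-mem _) (_ , v∈t , h) , h)))
            att : Attempt g
            att v z k with proj₁ (g-rel v z) k
            att v z k | inj₁ l with proj₁ (G-rel v z) l
            ... | v∈t , _ , h with unfold h
            ... | s , s-set , a , b , f′ = s , s-set
                , (λ w w∈s → let (x , x∈v , l) = a w w∈s in x , x∈v , H⇒g (t-trans v v∈t x x∈v) l)
                , (λ x x∈v → let (w , w∈s , l) = b x x∈v in w , w∈s , H⇒g (t-trans v v∈t x x∈v) l)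
                , f′
            att v z k | inj₂ (refl , refl) = r , r-set
                , (λ w w∈r → let (x , x∈u , l) = proj₁ (r-mem w) w∈r
                             in x , x∈u , H⇒g (t-trans u u∈t x x∈u) l)
                , (λ x x∈u → let (w , l) = ih x x∈u
                                 l′ = proj₁ (swap-⊩ HF) l
                             in w , proj₂ (r-mem w) (x , x∈u , l′) , H⇒g (t-trans u u∈t x x∈u) l′)
                , f

  -- Transitive closures and closure under singletons.

  opaque
    successorSet : ∃ λ I → Trans I × (∃ λ e → e ∈ I) × (∀ m → m ∈ I → ∃ λ k → k ∈ I × m ∈ k)
    successorSet with Ax.infinity
    ... | s , _ , (e , e∈s , e-set , e-empty) , s-succ
      with sep (∀∈ v0 (v0 ∈̇ v2) ∧̇ transF v0 ∧̇ ∀∈ v0 (transF v0)) (s ∷ []) s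
    ... | I , _ , I-mem = I , I-trans , (e , proj₂ (I-mem e)
        (e∈s , (λ z z∈e → ⊥e z∈e) , (λ z z∈e → ⊥e z∈e) , (λ z z∈e → ⊥e z∈e))) , I-succ
      where
      ⊥e : ∀ {z} {A : Set ℓ} → z ∈ e → A
      ⊥e z∈e = ⊥₀-elim (e-empty _ z∈e)
      I-trans : Trans I
      I-trans x x∈I y y∈x with proj₁ (I-mem x) x∈I
      ... | x∈s , x⊆s , x-trans , x-hered = proj₂ (I-mem y)
          ( x⊆s y y∈x , (λ z z∈y → x⊆s z (x-trans y y∈x z z∈y)) , x-hered y y∈x
          , (λ z z∈y → x-hered z (x-trans y y∈x z z∈y)))
      I-succ : ∀ m → m ∈ I → ∃ λ k → k ∈ I × m ∈ k
      I-succ m m∈I with proj₁ (I-mem m) m∈I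
      ... | m∈s , m⊆s , m-trans , m-hered with s-succ m m∈s
      ... | k , k∈s , _ , k-mem⇔ = k , proj₂ (I-mem k) (k∈s , k⊆s , k-trans , k-hered) , m∈k
        where
        k-mem : ∀ z → z ∈ k ↔ (z ∈ m ⊎ z ≡ m)
        k-mem z = from⇔ (k-mem⇔ z)
        m∈k : m ∈ k
        m∈k = proj₂ (k-mem m) (inj₂ refl)
        k⊆s : Sub k s
        k⊆s z z∈k with proj₁ (k-mem z) z∈k
        ... | inj₁ z∈m = m⊆s z z∈m
        ... | inj₂ refl = m∈s
        k-trans : Trans k
        k-trans z z∈k w w∈z with proj₁ (k-mem z) z∈k
        ... | inj₁ z∈m = proj₂ (k-mem w) (inj₁ (m-trans z z∈m w w∈z))
        ... | inj₂ refl = proj₂ (k-mem w) (inj₁ w∈z)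
        k-hered : ∀ z → z ∈ k → Trans z
        k-hered z z∈k with proj₁ (k-mem z) z∈k
        ... | inj₁ z∈m = m-hered z z∈m
        ... | inj₂ refl = m-trans

  -- The second condition makes t ↦ {t} an injection of T into itself that avoids ∅ and all
  -- urelements.
  Closed : Carrier → Set ℓ
  Closed T = Trans T × (∀ v w → v ∈ T → UPair w v v → w ∈ T)

  -- The union of the sets G(k), k ∈ I, with G(k) = x ∪ {w : ∃ m ∈ k, ∃ v ∈ G(m), w ∈ v or w = {v}}.
  module Closure (x : Carrier) where
    Φ : Formula 4
    Φ = setF v2 ∧̇ ∀̇ (v0 ∈̇ v3 ⇔̇
          (v0 ∈̇ v4 ∨̇ ∃∈ v2 (∃∈ v0 (v2 ∈̇ v0 ∨̇ unorderedPairF v2 v0 v0))))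
    Next : Carrier → Carrier → Set ℓ
    Next r w = w ∈ x ⊎ ∃ λ s → s ∈ r × ∃ λ v → v ∈ s × (w ∈ v ⊎ UPair w v v)
    opaque
      F-total : (u r : Carrier) → isSet r → ∃ λ y → isSet y × (∀ w → w ∈ y ↔ Next r w)
      F-total u r _ with union r
      ... | ur , _ , ur-mem with union ur
                               | replacement (unorderedPairF v1 v0 v0) [] ur
                                   (λ _ _ _ _ → upair-unique)
      ... | uur , _ , uur-mem | sg , _ , sg-mem with binaryUnion uur sg
      ... | c , _ , c-mem with binaryUnion x c
      ... | y , y-set , y-mem = y , y-set , λ w → to w , from w
        where
        to : ∀ w → w ∈ y → Next r w
        to w w∈y with proj₁ (y-mem w) w∈y
        ... | inj₁ w∈x = inj₁ w∈x
        ... | inj₂ w∈c with proj₁ (c-mem w) w∈c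
        ... | inj₁ w∈uur = let (v , v∈ur , w∈v) = proj₁ (uur-mem w) w∈uur
                               (s , s∈r , v∈s) = proj₁ (ur-mem v) v∈ur
                           in inj₂ (s , s∈r , v , v∈s , inj₁ w∈v)
        ... | inj₂ w∈sg = let (v , v∈ur , wv) = proj₁ (sg-mem w) w∈sg
                              (s , s∈r , v∈s) = proj₁ (ur-mem v) v∈ur
                          in inj₂ (s , s∈r , v , v∈s , inj₂ wv)
        from : ∀ w → Next r w → w ∈ y
        from w (inj₁ w∈x) = proj₂ (y-mem w) (inj₁ w∈x)
        from w (inj₂ (s , s∈r , v , v∈s , inj₁ w∈v)) = proj₂ (y-mem w) (inj₂ (proj₂ (c-mem w)
          (inj₁ (proj₂ (uur-mem w) (v , proj₂ (ur-mem v) (s , s∈r , v∈s) , w∈v)))))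
        from w (inj₂ (s , s∈r , v , v∈s , inj₂ wv)) = proj₂ (y-mem w) (inj₂ (proj₂ (c-mem w)
          (inj₂ (proj₂ (sg-mem w) (v , proj₂ (ur-mem v) (s , s∈r , v∈s) , wv)))))
    opaque
      F-unique : ∀ u r y y′ → u ∷ r ∷ y ∷ x ∷ [] ⊩ Φ → u ∷ r ∷ y′ ∷ x ∷ [] ⊩ Φ → y ≡ y′
      F-unique u r y y′ (s , h) (s′ , h′) = ext s s′
        (λ w w∈y → proj₂ (h′ w) (proj₁ (h w) w∈y))
        (λ w w∈y → proj₂ (h w) (proj₁ (h′ w) w∈y))
    module R where
      open Recursion (x ∷ []) Φ public
      open Solution F-total F-unique public

  opaque
    closure : ∀ x → ∃ λ T → Sub x T × Closed T
    closure x with successorSet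
    ... | I , I-trans , (e , e∈I) , I-succ
      with replacement (Closure.R.HF x) (x ∷ []) I (λ u v v′ u∈I → Closure.R.unique x I-trans u∈I)
    ... | Y , _ , Y-mem with union Y
    ... | T , _ , T-mem = T , x⊆T , T-trans , T-sing
      where
      module R = Closure.R x
      intro : ∀ {k y w} → k ∈ I → R.H k y → w ∈ y → w ∈ T
      intro k∈I h w∈y = proj₂ (T-mem _) (_ , proj₂ (Y-mem _) (_ , k∈I , h) , w∈y)
      next : ∀ {v w} → v ∈ T → w ∈ v ⊎ UPair w v v → w ∈ T
      next {v} {w} v∈T step with proj₁ (T-mem v) v∈T
      ... | y , y∈Y , v∈y with proj₁ (Y-mem y) y∈Y
      ... | m , m∈I , h with I-succ m m∈I
      ... | k , k∈I , m∈k with R.total I-trans k∈I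
      ... | y′ , h′ with R.unfold h′
      ... | r , _ , _ , b , _ , y′-mem with b m m∈k
      ... | z , z∈r , hz with R.unique I-trans m∈I hz h
      ... | refl = intro k∈I h′ (proj₂ (y′-mem w) (inj₂ (y , z∈r , v , v∈y , step)))
      x⊆T : Sub x T
      x⊆T w w∈x with R.total I-trans e∈I
      ... | y , h with R.unfold h
      ... | _ , _ , _ , _ , _ , y-mem = intro e∈I h (proj₂ (y-mem w) (inj₁ w∈x))
      T-trans : Trans T
      T-trans v v∈T w w∈v = next v∈T (inj₁ w∈v)
      T-sing : ∀ v w → v ∈ T → UPair w v v → w ∈ T
      T-sing v w v∈T wv = next v∈T (inj₂ wv)

  opaque
    closure₂ : ∀ x y → ∃ λ T → x ∈ T × y ∈ T × Closed T
    closure₂ x y with upair x y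
    ... | p , p-pair with closure p
    ... | T , p⊆T , c = T , p⊆T x (proj₂ (p-pair x) (inj₁ refl))
                          , p⊆T y (proj₂ (p-pair y) (inj₂ refl)) , c

  opaque
    transitiveSet : ∀ x → ∃ λ t → x ∈ t × Trans t
    transitiveSet x = let (t , x∈t , _ , t-trans , _) = closure₂ x x in t , x∈t , t-trans

  opaque
    ∈-induction : (φ : Formula (suc n)) (ρ : Vec Carrier n) →
                  (∀ x → (∀ y → y ∈ x → y ∷ ρ ⊩ φ) → x ∷ ρ ⊩ φ) → ∀ x → x ∷ ρ ⊩ φ
    ∈-induction φ ρ step x with transitiveSet x
    ... | t , x∈t , t-trans = induction φ ρ t t-trans (λ y _ → step y) x x∈t

  opaque
    -- The transitive closure of {x}. Minimality is what makes it stable under every automorphism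
    -- that fixes x.
    minimalTransitive : ∀ x → ∃ λ t → x ∈ t × Trans t × (∀ s → x ∈ s → Trans s → Sub t s)
    minimalTransitive x with transitiveSet x
    ... | E , x∈E , E-trans
      with sep (∀̇ (v2 ∈̇ v0 ⇒̇ transF v0 ⇒̇ v1 ∈̇ v0)) (x ∷ []) E
    ... | t , _ , t-mem = t , proj₂ (t-mem x) (x∈E , λ s x∈s _ → x∈s)
        , (λ y y∈t z z∈y → let (y∈E , h) = proj₁ (t-mem y) y∈t in
             proj₂ (t-mem z) (E-trans y y∈E z z∈y , λ s x∈s s-trans → s-trans y (h s x∈s s-trans) z z∈y))
        , (λ s x∈s s-trans y y∈t → proj₂ (proj₁ (t-mem y) y∈t) s x∈s s-trans)

  -- Involutive automorphisms and their action on classes.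

  -- A map of the metatheory, not an object of the model. Since it is its own inverse, preservation
  -- in one direction gives the other.
  record Involution : Set ℓ where
    field
      π          : Carrier → Carrier
      involutive : ∀ x → π (π x) ≡ x
      π-∈        : ∀ {x y} → x ∈ y → π x ∈ π y
      π-𝒜        : ∀ {x} → 𝒜 x → 𝒜 (π x)

    π-∈⁻¹ : ∀ {x y} → π x ∈ π y → x ∈ y
    π-∈⁻¹ {x} {y} h = subst (_∈ y) (involutive x) (subst (π (π x) ∈_) (involutive y) (π-∈ h))

    π-𝒜⁻¹ : ∀ {x} → 𝒜 (π x) → 𝒜 x
    π-𝒜⁻¹ {x} h = subst 𝒜 (involutive x) (π-𝒜 h)

    π-injective : ∀ {x y} → π x ≡ π y → x ≡ y
    π-injective {x} {y} h = trans (sym (involutive x)) (trans (cong π h) (involutive y))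

    -- This is the pointwise image of the class: by `invariant`, π x satisfies ψ with parameter π z
    -- exactly when x does with z.
    πᶜ : Class U → Class U
    πᶜ ⟨ ψ , z ⟩ = ⟨ ψ , π z ⟩

    πᶜ-involutive : ∀ X → πᶜ (πᶜ X) ≡ X
    πᶜ-involutive ⟨ ψ , z ⟩ = cong ⟨ ψ ,_⟩ (involutive z)

    invariant : (φ : Formula n) (ρ : Vec Carrier n) → (ρ ⊩ φ) ↔ (map π ρ ⊩ φ)
    invariant (i ≐ j) ρ rewrite lookup-map i π ρ | lookup-map j π ρ = cong π , π-injective
    invariant (i ∈̇ j) ρ rewrite lookup-map i π ρ | lookup-map j π ρ = π-∈ , π-∈⁻¹
    invariant (𝒜̇ i) ρ rewrite lookup-map i π ρ = π-𝒜 , π-𝒜⁻¹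
    invariant ⊥̇ ρ = (λ x → x) , (λ x → x)
    invariant (φ ⇒̇ ψ) ρ with invariant φ ρ | invariant ψ ρ
    ... | (a , b) | (c , d) = (λ h x → c (h (b x))) , (λ h x → d (h (a x)))
    invariant (φ ∧̇ ψ) ρ with invariant φ ρ | invariant ψ ρ
    ... | (a , b) | (c , d) = (λ (x , y) → a x , c y) , (λ (x , y) → b x , d y)
    invariant (φ ∨̇ ψ) ρ with invariant φ ρ | invariant ψ ρ
    ... | (a , b) | (c , d) = [ (λ x → inj₁ (a x)) , (λ y → inj₂ (c y)) ]′
                            , [ (λ x → inj₁ (b x)) , (λ y → inj₂ (d y)) ]′
    invariant (∀̇ φ) ρ =
        (λ h x → subst (λ w → w ∷ map π ρ ⊩ φ) (involutive x)
                   (proj₁ (invariant φ (π x ∷ ρ)) (h (π x))))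
      , (λ h x → proj₂ (invariant φ (x ∷ ρ)) (h (π x)))
    invariant (∃̇ φ) ρ =
        (λ (x , h) → π x , proj₁ (invariant φ (x ∷ ρ)) h)
      , (λ (x , h) → π x , proj₂ (invariant φ (π x ∷ ρ))
                             (subst (λ w → w ∷ map π ρ ⊩ φ) (sym (involutive x)) h))

    invariantᶜ : ∀ x X → (_∈ᶜ_ U x X) ↔ (_∈ᶜ_ U (π x) (πᶜ X))
    invariantᶜ x ⟨ ψ , z ⟩ = invariant ψ (x ∷ z ∷ [])

    -- Class quantifiers behave like object quantifiers, because `πᶜ` permutes the presentations of
    -- definable classes.
    invariant₂ : (φ : Formula₂ m n) (Γ : Vec (Class U) m) (ρ : Vec Carrier n) →
                 (_,_⊨₂_ U Γ ρ φ) ↔ (_,_⊨₂_ U (map πᶜ Γ) (map π ρ) φ)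
    invariant₂ (i ≐ j) Γ ρ rewrite lookup-map i π ρ | lookup-map j π ρ = cong π , π-injective
    invariant₂ (i ∈̇ j) Γ ρ rewrite lookup-map i π ρ | lookup-map j π ρ = π-∈ , π-∈⁻¹
    invariant₂ (𝒜̇ i) Γ ρ rewrite lookup-map i π ρ = π-𝒜 , π-𝒜⁻¹
    invariant₂ (i ∈̇ᶜ k) Γ ρ rewrite lookup-map i π ρ | lookup-map k πᶜ Γ =
      invariantᶜ (lookup ρ i) (lookup Γ k)
    invariant₂ ⊥̇ Γ ρ = (λ x → x) , (λ x → x)
    invariant₂ (φ ⇒̇ ψ) Γ ρ with invariant₂ φ Γ ρ | invariant₂ ψ Γ ρ
    ... | (a , b) | (c , d) = (λ h x → c (h (b x))) , (λ h x → d (h (a x)))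
    invariant₂ (φ ∧̇ ψ) Γ ρ with invariant₂ φ Γ ρ | invariant₂ ψ Γ ρ
    ... | (a , b) | (c , d) = (λ (x , y) → a x , c y) , (λ (x , y) → b x , d y)
    invariant₂ (φ ∨̇ ψ) Γ ρ with invariant₂ φ Γ ρ | invariant₂ ψ Γ ρ
    ... | (a , b) | (c , d) = [ (λ x → inj₁ (a x)) , (λ y → inj₂ (c y)) ]′
                            , [ (λ x → inj₁ (b x)) , (λ y → inj₂ (d y)) ]′
    invariant₂ (∀̇ φ) Γ ρ =
        (λ h x → subst (λ w → _,_⊨₂_ U (map πᶜ Γ) (w ∷ map π ρ) φ) (involutive x)
                   (proj₁ (invariant₂ φ Γ (π x ∷ ρ)) (h (π x))))
      , (λ h x → proj₂ (invariant₂ φ Γ (x ∷ ρ)) (h (π x)))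
    invariant₂ (∃̇ φ) Γ ρ =
        (λ (x , h) → π x , proj₁ (invariant₂ φ Γ (x ∷ ρ)) h)
      , (λ (x , h) → π x , proj₂ (invariant₂ φ Γ (π x ∷ ρ))
          (subst (λ w → _,_⊨₂_ U (map πᶜ Γ) (w ∷ map π ρ) φ) (sym (involutive x)) h))
    invariant₂ (∀̇ᶜ φ) Γ ρ =
        (λ h X → subst (λ w → _,_⊨₂_ U (w ∷ map πᶜ Γ) (map π ρ) φ) (πᶜ-involutive X)
                   (proj₁ (invariant₂ φ (πᶜ X ∷ Γ) ρ) (h (πᶜ X))))
      , (λ h X → proj₂ (invariant₂ φ (X ∷ Γ) ρ) (h (πᶜ X)))
    invariant₂ (∃̇ᶜ φ) Γ ρ =
        (λ (X , h) → πᶜ X , proj₁ (invariant₂ φ (X ∷ Γ) ρ) h)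
      , (λ (X , h) → πᶜ X , proj₂ (invariant₂ φ (πᶜ X ∷ Γ) ρ)
          (subst (λ w → _,_⊨₂_ U (w ∷ map πᶜ Γ) (map π ρ) φ) (sym (πᶜ-involutive X)) h))

  -- Extending a set-coded involution of urelements to the universe.

  module Extension (s : Carrier)
    (s-sym : ∀ {a b} → Rel s a b → Rel s b a)
    (s-fun : ∀ {a b b′} → Rel s a b → Rel s a b′ → b ≡ b′)
    (s-𝒜   : ∀ {a b} → Rel s a b → 𝒜 a)
    where

    private
      -- A urelement goes to its `s`-partner, or to itself if it has none; a set goes to the set r
      -- of the values at its members.
      Φ : Formula 4
      Φ = (𝒜̇ v0 ∧̇ (relF v3 v0 v2 ∨̇ (¬̇ ∃̇ relF v4 v1 v0) ∧̇ v2 ≐ v0)) ∨̇ (setF v0 ∧̇ v2 ≐ v1)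

      F-total : ∀ u r → isSet r → ∃ λ y → u ∷ r ∷ y ∷ s ∷ [] ⊩ Φ
      F-total u r _ with dec-𝒜 u
      ... | inj₂ u-set = r , inj₂ (u-set , refl)
      ... | inj₁ u-ur with dec (∃̇ relF v2 v1 v0) (u ∷ s ∷ [])
      ... | inj₁ (c , h) = c , inj₁ (u-ur , inj₁ h)
      ... | inj₂ ¬h = u , inj₁ (u-ur , inj₂ (¬h , refl))

      F-unique : ∀ u r y y′ → u ∷ r ∷ y ∷ s ∷ [] ⊩ Φ → u ∷ r ∷ y′ ∷ s ∷ [] ⊩ Φ → y ≡ y′
      F-unique u r y y′ (inj₂ (_ , refl)) (inj₂ (_ , refl)) = refl
      F-unique u r y y′ (inj₂ (u-set , _)) (inj₁ (u-ur , _)) = ⊥-elim (u-set u-ur)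
      F-unique u r y y′ (inj₁ (u-ur , _)) (inj₂ (u-set , _)) = ⊥-elim (u-set u-ur)
      F-unique u r y y′ (inj₁ (_ , inj₁ h)) (inj₁ (_ , inj₁ h′)) = s-fun h h′
      F-unique u r y y′ (inj₁ (_ , inj₁ h)) (inj₁ (_ , inj₂ (¬h , _))) = ⊥-elim (¬h (_ , h))
      F-unique u r y y′ (inj₁ (_ , inj₂ (¬h , _))) (inj₁ (_ , inj₁ h)) = ⊥-elim (¬h (_ , h))
      F-unique u r y y′ (inj₁ (_ , inj₂ (_ , refl))) (inj₁ (_ , inj₂ (_ , refl))) = refl

      module R where
        open Recursion (s ∷ []) Φ public
        open Solution F-total F-unique public

    abstract
      π : Carrier → Carrier
      π x = let (t , x∈t , t-trans) = transitiveSet x in proj₁ (R.total t-trans x∈t)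

      π-H : ∀ x → R.H x (π x)
      π-H x = let (t , x∈t , t-trans) = transitiveSet x in proj₂ (R.total t-trans x∈t)

    H⇒π : ∀ {x y} → R.H x y → y ≡ π x
    H⇒π {x} h = let (t , x∈t , t-trans) = transitiveSet x in R.unique t-trans x∈t h (π-H x)

    π-rel : ∀ {a b} → Rel s a b → π a ≡ b
    π-rel {a} h with R.unfold (π-H a)
    ... | _ , _ , _ , _ , inj₁ (_ , inj₁ h′) = s-fun h′ h
    ... | _ , _ , _ , _ , inj₁ (_ , inj₂ (¬h , _)) = ⊥-elim (¬h (_ , h))
    ... | _ , _ , _ , _ , inj₂ (a-set , _) = ⊥-elim (a-set (s-𝒜 h))

    π-fixed : ∀ {a} → 𝒜 a → (∀ b → Neg (Rel s a b)) → π a ≡ a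
    π-fixed {a} a-ur ¬h with R.unfold (π-H a)
    ... | _ , _ , _ , _ , inj₁ (_ , inj₁ h) = ⊥-elim (¬h _ h)
    ... | _ , _ , _ , _ , inj₁ (_ , inj₂ (_ , e)) = e
    ... | _ , _ , _ , _ , inj₂ (a-set , _) = ⊥-elim (a-set a-ur)

    π-set : ∀ {x} → isSet x → isSet (π x) × (∀ z → z ∈ π x ↔ ∃ λ v → v ∈ x × z ≡ π v)
    π-set {x} x-set with R.unfold (π-H x)
    ... | _ , _ , _ , _ , inj₁ (x-ur , _) = ⊥-elim (x-set x-ur)
    ... | r , r-set , a , b , inj₂ (_ , e) rewrite e = r-set , λ z →
          (λ z∈r → let (v , v∈x , h) = a z z∈r in v , v∈x , H⇒π h)
        , (λ (v , v∈x , z≡) → let (w , w∈r , h) = b v v∈x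
                              in subst (_∈ r) (trans (H⇒π h) (sym z≡)) w∈r)

    π-𝒜 : ∀ {x} → 𝒜 x → 𝒜 (π x)
    π-𝒜 {x} x-ur with dec (∃̇ relF v2 v1 v0) (x ∷ s ∷ [])
    ... | inj₁ (c , h) = subst 𝒜 (sym (π-rel h)) (s-𝒜 (s-sym h))
    ... | inj₂ ¬h = subst 𝒜 (sym (π-fixed x-ur (λ b h → ¬h (b , h)))) x-ur

    private
      involutive : ∀ x → π (π x) ≡ x
      -- `π` is no symbol of the language, so the induction is on the formula saying that some y has
      -- h(x) = y and h(y) = x.
      involutive x with ∈-induction (∃̇ (swap R.HF ∧̇ R.HF)) (s ∷ [])
                          (λ x ih → toF (step x (λ y y∈x → fromF (ih y y∈x)))) x
        where
        toF : ∀ {x} → π (π x) ≡ x → ∃ λ y → (y ∷ x ∷ s ∷ [] ⊩ swap R.HF) × R.H y x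
        toF {x} e = π x , proj₂ (swap-⊩ R.HF) (π-H x) , subst (R.H (π x)) e (π-H (π x))
        fromF : ∀ {x} → (∃ λ y → (y ∷ x ∷ s ∷ [] ⊩ swap R.HF) × R.H y x) → π (π x) ≡ x
        fromF (y , h , h′) with H⇒π (proj₁ (swap-⊩ R.HF) h)
        ... | refl = sym (H⇒π h′)
        step : ∀ x → (∀ y → y ∈ x → π (π y) ≡ y) → π (π x) ≡ x
        step x ih with dec-𝒜 x
        ... | inj₁ x-ur with dec (∃̇ relF v2 v1 v0) (x ∷ s ∷ [])
        ... | inj₁ (c , h) = trans (cong π (π-rel h)) (π-rel (s-sym h))
        ... | inj₂ ¬h = trans (cong π fix) fix
          where
          fix = π-fixed x-ur (λ b h → ¬h (b , h))
        step x ih | inj₂ x-set with π-set x-set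
        ... | πx-set , πx-mem with π-set πx-set
        ... | ππx-set , ππx-mem = ext ππx-set x-set to from
          where
          to : Sub (π (π x)) x
          to z z∈ with proj₁ (ππx-mem z) z∈
          ... | w , w∈ , refl with proj₁ (πx-mem w) w∈
          ... | v , v∈x , refl = subst (_∈ x) (sym (ih v v∈x)) v∈x
          from : Sub x (π (π x))
          from z z∈x = proj₂ (ππx-mem z) (π z , proj₂ (πx-mem (π z)) (z , z∈x , refl) , sym (ih z z∈x))
      ... | y , h , h′ with H⇒π (proj₁ (swap-⊩ R.HF) h)
      ... | refl = sym (H⇒π h′)

    involution : Involution
    involution = record
      { π = π
      ; involutive = involutive
      ; π-∈ = λ {x} {y} x∈y → proj₂ (proj₂ (π-set (inhabited⇒set x∈y)) (π x)) (x , x∈y , refl)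
      ; π-𝒜 = π-𝒜
      }

    fixes : ∀ {t} → Trans t → (∀ a → a ∈ t → 𝒜 a → ∀ b → Neg (Rel s a b)) →
            ∀ x → x ∈ t → π x ≡ x
    fixes {t} t-trans moved x x∈t
      with induction (∃̇ (swap R.HF ∧̇ v0 ≐ v1)) (s ∷ []) t t-trans step x x∈t
      where
      step : ∀ x → x ∈ t → (∀ y → y ∈ x → ∃ λ z → (z ∷ y ∷ s ∷ [] ⊩ swap R.HF) × z ≡ y) →
             ∃ λ z → (z ∷ x ∷ s ∷ [] ⊩ swap R.HF) × z ≡ x
      step x x∈t ih = π x , proj₂ (swap-⊩ R.HF) (π-H x) , fix
        where
        ih′ : ∀ y → y ∈ x → π y ≡ y
        ih′ y y∈x with ih y y∈x
        ... | z , h , refl = sym (H⇒π (proj₁ (swap-⊩ R.HF) h))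
        fix : π x ≡ x
        fix with dec-𝒜 x
        ... | inj₁ x-ur = π-fixed x-ur (moved x x∈t x-ur)
        ... | inj₂ x-set with π-set x-set
        ... | πx-set , πx-mem = ext πx-set x-set
          (λ z z∈ → let (v , v∈x , e) = proj₁ (πx-mem z) z∈
                    in subst (_∈ x) (sym (trans e (ih′ v v∈x))) v∈x)
          (λ z z∈x → proj₂ (πx-mem z) (z , z∈x , sym (ih′ z z∈x)))
    ... | z , h , refl = sym (H⇒π (proj₁ (swap-⊩ R.HF) h))

  -- Ordinals and the Hartogs number.

  -- With Foundation, a transitive set of transitive sets is well-ordered by ∈. This form is short
  -- enough for use inside formulas; `ord⇒IsOrdinal` recovers the official one.
  Ord : Carrier → Set ℓ
  Ord α = isSet α × Trans α × (∀ x → x ∈ α → isSet x × Trans x)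

  Comparable : Carrier → Carrier → Set ℓ
  Comparable α β = α ∈ β ⊎ α ≡ β ⊎ β ∈ α

  ord-∈ : ∀ {α β} → Ord α → β ∈ α → Ord β
  ord-∈ (_ , α-trans , α-hered) β∈α = proj₁ (α-hered _ β∈α) , proj₂ (α-hered _ β∈α) ,
    λ x x∈β → α-hered x (α-trans _ β∈α x x∈β)

  opaque
    -- Nested ∈-induction: if neither ordinal equals or belongs to a member of the other, the
    -- induction hypotheses make each a subset of the other.
    comparable : ∀ {α β} → Ord α → Ord β → Comparable α β
    comparable {α} {β} oα oβ =
      ∈-induction (∀̇ (ordF v1 ⇒̇ ordF v0 ⇒̇ comparableF v1 v0)) [] outer α β oα oβ
      where
      outer : ∀ α → (∀ a → a ∈ α → ∀ β → Ord a → Ord β → Comparable a β) →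
              ∀ β → Ord α → Ord β → Comparable α β
      outer α ihα β oα = ∈-induction (ordF v0 ⇒̇ comparableF v1 v0) (α ∷ []) inner β
        where
        inner : ∀ β → (∀ b → b ∈ β → Ord b → Comparable α b) → Ord β → Comparable α β
        inner β ihβ oβ with dec (∃∈ v0 (v2 ≐ v0 ∨̇ v2 ∈̇ v0)) (α ∷ β ∷ [])
        ... | inj₁ (a , a∈α , inj₁ refl) = inj₂ (inj₂ a∈α)
        ... | inj₁ (a , a∈α , inj₂ β∈a) = inj₂ (inj₂ (proj₁ (proj₂ oα) a a∈α β β∈a))
        ... | inj₂ ¬above with dec (∃∈ v1 (v1 ≐ v0 ∨̇ v1 ∈̇ v0)) (α ∷ β ∷ [])
        ... | inj₁ (b , b∈β , inj₁ refl) = inj₁ b∈β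
        ... | inj₁ (b , b∈β , inj₂ α∈b) = inj₁ (proj₁ (proj₂ oβ) b b∈β α α∈b)
        ... | inj₂ ¬below = inj₂ (inj₁ (ext (proj₁ oα) (proj₁ oβ) to from))
          where
          to : Sub α β
          to a a∈α with ihα a a∈α β (ord-∈ oα a∈α) oβ
          ... | inj₁ a∈β = a∈β
          ... | inj₂ (inj₁ a≡β) = ⊥-elim (¬above (a , a∈α , inj₁ (sym a≡β)))
          ... | inj₂ (inj₂ β∈a) = ⊥-elim (¬above (a , a∈α , inj₂ β∈a))
          from : Sub β α
          from b b∈β with ihβ b b∈β (ord-∈ oβ b∈β)
          ... | inj₁ α∈b = ⊥-elim (¬below (b , b∈β , inj₂ α∈b))
          ... | inj₂ (inj₁ α≡b) = ⊥-elim (¬below (b , b∈β , inj₁ α≡b))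
          ... | inj₂ (inj₂ b∈α) = b∈α

  Injective : Carrier → Set ℓ
  Injective f = ∀ a a′ t → Rel f a t → Rel f a′ t → a ≡ a′

  Total : Carrier → Carrier → Carrier → Set ℓ
  Total f x T = ∀ a → a ∈ x → ∃ λ t → t ∈ T × Rel f a t

  -- f need not be single-valued: Small x T says that x is an image of a subset of T.
  Small : Carrier → Carrier → Set ℓ
  Small x T = ∃ λ f → Total f x T × Injective f

  Segment : Carrier → Carrier → Carrier → Carrier → Set ℓ
  Segment T f β c = isSet c × (∀ t → t ∈ c ↔ (t ∈ T × ∃ λ γ → γ ∈ β × Rel f γ t))

  segment-unique : ∀ {T f β c c′} → Segment T f β c → Segment T f β c′ → c ≡ c′
  segment-unique (s , h) (s′ , h′) = ext s s′
    (λ t t∈c → proj₂ (h′ t) (proj₁ (h t) t∈c)) (λ t t∈c → proj₂ (h t) (proj₁ (h′ t) t∈c))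

  -- A value of f at γ lies in f[β], but by injectivity it lies in f[γ] only if γ ∈ γ.
  segment-strict : ∀ {T f α β γ c c′} → Total f α T → Injective f → Trans α → β ∈ α → γ ∈ β →
    Segment T f β c → Segment T f γ c′ → Neg (Sub c c′)
  segment-strict {α = α} {β} {γ} f-tot f-inj α-trans β∈α γ∈β (_ , c-mem) (_ , c′-mem) c⊆c′
    with f-tot γ (α-trans β β∈α γ γ∈β)
  ... | t , t∈T , h with proj₁ (c′-mem t) (c⊆c′ t (proj₂ (c-mem t) (t∈T , γ , γ∈β , h)))
  ... | _ , δ , δ∈γ , h′ with f-inj δ γ t h′ h
  ... | refl = ∈-irrefl δ∈γ

  segment-reflects : ∀ {T f β γ c c′} → Ord β → Ord γ →
    Segment T f β c → Segment T f γ c′ → Neg (Sub c c′) → γ ∈ β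
  segment-reflects {β = β} {γ} {c} {c′} oβ oγ (_ , c-mem) (_ , c′-mem) c⊈c′ with comparable oγ oβ
  ... | inj₁ γ∈β = γ∈β
  ... | inj₂ β≤γ = ⊥-elim (c⊈c′ λ t t∈c →
          let (t∈T , δ , δ∈β , h) = proj₁ (c-mem t) t∈c in proj₂ (c′-mem t) (t∈T , δ , sub β≤γ δ δ∈β , h))
    where
    sub : γ ≡ β ⊎ β ∈ γ → Sub β γ
    sub (inj₁ refl) δ δ∈β = δ∈β
    sub (inj₂ β∈γ) δ δ∈β = proj₁ (proj₂ oγ) β β∈γ δ δ∈β

  -- An ordinal α with f : α → T is determined by the set C = {f[β] : β ∈ α} ⊆ 𝒫(T), which
  -- bounds the class of such ordinals by a set.
  Codes : Carrier → Carrier → Carrier → Carrier → Set ℓ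
  Codes T C α f = Total f α T × Injective f ×
    (∀ β → β ∈ α → ∃ λ c → c ∈ C × Segment T f β c) ×
    (∀ c → c ∈ C → ∃ λ β → β ∈ α × Segment T f β c)

  codeF : Formula 3
  codeF = ordF v1 ∧̇ ∃̇ (∀∈ v2 (∃∈ v4 (relF v2 v1 v0)) ∧̇ injectiveF v0 ∧̇
    ∀∈ v2 (∃∈ v2 (segmentF v5 v2 v1 v0)) ∧̇
    ∀∈ v1 (∃∈ v3 (segmentF v5 v2 v0 v1)))

  opaque
    -- Both codes list the same segments, and inclusion of segments reflects the order of the
    -- ordinals. By induction on β, the members of β and those of β′ therefore correspond to the
    -- same segments, namely those in `C` that do not include c.
    code-segment : ∀ {T C α α′ f f′} → Ord α → Ord α′ → Codes T C α f → Codes T C α′ f′ →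
      ∀ {β β′ c} → β ∈ α → β′ ∈ α′ → Segment T f β c → Segment T f′ β′ c → β ≡ β′
    code-segment {T} {C} {α} {α′} {f} {f′} oα oα′ (tot , inj , cov , cov⁻¹) (tot′ , inj′ , cov′ , cov′⁻¹)
      {β} {β′} {c} β∈α β′∈α′ s s′ =
      induction (∀̇ ∀̇ (v1 ∈̇ v3 ⇒̇ segmentF (suc v5) v4 v2 v0 ⇒̇ segmentF (suc v5) v5 v1 v0 ⇒̇ v2 ≐ v1))
        (α′ ∷ f ∷ f′ ∷ T ∷ []) α (proj₁ (proj₂ oα)) step β β∈α β′ c β′∈α′ s s′
      where
      Q : Carrier → Set ℓ
      Q β = ∀ β′ c → β′ ∈ α′ → Segment T f β c → Segment T f′ β′ c → β ≡ β′
      step : ∀ β → β ∈ α → (∀ γ → γ ∈ β → Q γ) → Q β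
      step β β∈α ih β′ c β′∈α′ s s′ = ext (proj₁ oβ) (proj₁ oβ′) to from
        where
        oβ : Ord β
        oβ = ord-∈ oα β∈α
        oβ′ : Ord β′
        oβ′ = ord-∈ oα′ β′∈α′
        to : Sub β β′
        to γ γ∈β with cov γ (proj₁ (proj₂ oα) β β∈α γ γ∈β)
        ... | d , d∈C , sγ with cov′⁻¹ d d∈C
        ... | γ′ , γ′∈α′ , sγ′ with ih γ γ∈β γ′ d γ′∈α′ sγ sγ′
        ... | refl = segment-reflects oβ′ (ord-∈ oα′ γ′∈α′) s′ sγ′
                       (segment-strict tot inj (proj₁ (proj₂ oα)) β∈α γ∈β s sγ)
        from : Sub β′ β
        from γ′ γ′∈β′ with cov′ γ′ (proj₁ (proj₂ oα′) β′ β′∈α′ γ′ γ′∈β′)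
        ... | d , d∈C , sγ′ with cov⁻¹ d d∈C
        ... | γ , γ∈α , sγ
          with segment-reflects oβ (ord-∈ oα γ∈α) s sγ
                 (segment-strict tot′ inj′ (proj₁ (proj₂ oα′)) β′∈α′ γ′∈β′ s′ sγ′)
        ... | γ∈β with ih γ γ∈β γ′ d (proj₁ (proj₂ oα′) β′ β′∈α′ γ′ γ′∈β′) sγ sγ′
        ... | refl = γ∈β

    code-subset : ∀ {T C α α′ f f′} → Ord α → Ord α′ → Codes T C α f → Codes T C α′ f′ → Sub α α′
    code-subset oα oα′ k@(_ , _ , cov , _) k′@(_ , _ , _ , cov′⁻¹) β β∈α with cov β β∈α
    ... | c , c∈C , s with cov′⁻¹ c c∈C
    ... | β′ , β′∈α′ , s′ with code-segment oα oα′ k k′ β∈α β′∈α′ s s′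
    ... | refl = β′∈α′

    hartogs : ∀ T → ∃ λ κ → Ord κ × (∀ α → α ∈ κ ↔ (Ord α × Small α T))
    hartogs T with power T
    ... | P , P-mem with power P
    ... | PP , PP-mem
      with replacement codeF (T ∷ []) PP (λ C α α′ _ (oα , _ , k) (oα′ , _ , k′) →
             ext (proj₁ oα) (proj₁ oα′) (code-subset oα oα′ k k′) (code-subset oα′ oα k′ k))
    ... | κ , κ-set , κ-mem = κ , (κ-set , κ-trans , κ-hered) , λ α → to α , from α
      where
      to : ∀ α → α ∈ κ → Ord α × Small α T
      to α α∈κ with proj₁ (κ-mem α) α∈κ
      ... | _ , _ , oα , f , tot , inj , _ = oα , f , tot , inj
      from : ∀ α → Ord α × Small α T → α ∈ κ
      from α (oα , f , tot , inj)
        with replacement (segmentF v3 v2 v0 v1) (f ∷ T ∷ []) α (λ _ _ _ _ → segment-unique)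
      ... | C , C-set , C-mem =
        proj₂ (κ-mem α) (C , proj₂ (PP-mem C) (C-set , C⊆P) , oα , f , tot , inj , cov , cov⁻¹)
        where
        C⊆P : Sub C P
        C⊆P c c∈C with proj₁ (C-mem c) c∈C
        ... | β , _ , c-set , c-mem = proj₂ (P-mem c) (c-set , λ t t∈c → proj₁ (proj₁ (c-mem t) t∈c))
        cov : ∀ β → β ∈ α → ∃ λ c → c ∈ C × Segment T f β c
        cov β β∈α with sep (∃∈ v1 (relF v3 v0 v1)) (β ∷ f ∷ []) T
        ... | c , s = c , proj₂ (C-mem c) (β , β∈α , s) , s
        cov⁻¹ : ∀ c → c ∈ C → ∃ λ β → β ∈ α × Segment T f β c
        cov⁻¹ c c∈C = proj₁ (C-mem c) c∈C
      κ-trans : Trans κ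
      κ-trans α α∈κ β β∈α with to α α∈κ
      ... | oα , f , tot , inj =
        from β (ord-∈ oα β∈α , f , (λ γ γ∈β → tot γ (proj₁ (proj₂ oα) β β∈α γ γ∈β)) , inj)
      κ-hered : ∀ α → α ∈ κ → isSet α × Trans α
      κ-hered α α∈κ with to α α∈κ
      ... | (α-set , α-trans , _) , _ = α-set , α-trans

  ord⇒IsOrdinal : ∀ {κ} → Ord κ → IsOrdinal U κ
  ord⇒IsOrdinal {κ} oκ@(κ-set , κ-trans , κ-hered) = κ-trans
    , (to¬ κ-set , κ , (to¬ κ-set , (λ _ h → h) , κ-trans , (λ _ _ h _ → h))
                 , λ y y∈κ → to¬ (proj₁ (κ-hered y y∈κ)))
    , record
      { irreflexive = λ _ _ → to¬ ∈-irrefl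
      ; transitive = λ u v w _ _ w∈κ u∈v v∈w → proj₂ (κ-hered w w∈κ) v v∈w u u∈v
      ; total = total
      ; least = least
      }
    where
    total : ∀ u v → u ∈ κ → v ∈ κ → u ≡ v ⊎ (u ∈ v ⊎ v ∈ u)
    total u v u∈κ v∈κ with comparable (ord-∈ oκ u∈κ) (ord-∈ oκ v∈κ)
    ... | inj₁ h = inj₂ (inj₁ h)
    ... | inj₂ (inj₁ h) = inj₁ h
    ... | inj₂ (inj₂ h) = inj₂ (inj₂ h)
    least : ∀ s → Sub s κ → (∃ λ u → u ∈ s) → ∃ λ u → u ∈ s × (∀ v → v ∈ s → u ≡ v ⊎ u ∈ v)
    least s s⊆κ (_ , h) with foundation h
    ... | u , u∈s , u-min = u , u∈s , λ v v∈s → le v v∈s (total u v (s⊆κ u u∈s) (s⊆κ v v∈s))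
      where
      le : ∀ v → v ∈ s → u ≡ v ⊎ (u ∈ v ⊎ v ∈ u) → u ≡ v ⊎ u ∈ v
      le v v∈s (inj₁ e) = inj₁ e
      le v v∈s (inj₂ (inj₁ u∈v)) = inj₂ u∈v
      le v v∈s (inj₂ (inj₂ v∈u)) = ⊥-elim (u-min v v∈s v∈u)

  -- Bijections and ordered pairs in working form.

  private
    toUPair : ∀ {p a b} → IsUnorderedPair U p a b → UPair p a b
    toUPair h z = from⇔ (h z)

    fromUPair : ∀ {p a b} → UPair p a b → IsUnorderedPair U p a b
    fromUPair h z = mk⇔ (proj₁ (h z)) (proj₂ (h z))

    toOPair : ∀ {p a b} → IsOrderedPair U p a b → OPair p a b
    toOPair h z = (λ z∈p → [ (λ k → inj₁ (toUPair k)) , (λ k → inj₂ (toUPair k)) ]′ (Equivalence.to (h z) z∈p))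
      , λ k → Equivalence.from (h z) ([ (λ l → inj₁ (fromUPair l)) , (λ l → inj₂ (fromUPair l)) ]′ k)

    fromOPair : ∀ {p a b} → OPair p a b → IsOrderedPair U p a b
    fromOPair h z = mk⇔
      (λ z∈p → [ (λ k → inj₁ (fromUPair k)) , (λ k → inj₂ (fromUPair k)) ]′ (proj₁ (h z) z∈p))
      (λ k → proj₂ (h z) ([ (λ l → inj₁ (toUPair l)) , (λ l → inj₂ (toUPair l)) ]′ k))

    toRel : ∀ {f a b} → Relates U f a b → Rel f a b
    toRel (p , p∈f , h) = p , p∈f , toOPair h

    fromRel : ∀ {f a b} → Rel f a b → Relates U f a b
    fromRel (p , p∈f , h) = p , p∈f , fromOPair h

  record Bijection (f x y : Carrier) : Set ℓ where
    field
      domain     : ∀ {a b} → Rel f a b → a ∈ x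
      range      : ∀ {a b} → Rel f a b → b ∈ y
      image      : ∀ {a} → a ∈ x → ∃ λ b → Rel f a b
      preimage   : ∀ {b} → b ∈ y → ∃ λ a → Rel f a b
      functional : ∀ {a b b′} → Rel f a b → Rel f a b′ → b ≡ b′
      injective  : ∀ {a a′ b} → Rel f a b → Rel f a′ b → a ≡ a′

  fromIsBijection : ∀ {f x y} → IsBijection U f x y → Bijection f x y
  fromIsBijection {f} {x} {y} bij = record
    { domain = λ h → proj₁ (ends h)
    ; range = λ h → proj₂ (ends h)
    ; image = λ a∈x → let (b , h , _) = B.functional _ a∈x in b , toRel h
    ; preimage = λ b∈y → let (a , h , _) = B.bijective _ b∈y in a , toRel h
    ; functional = λ h h′ → let (_ , _ , u) = B.functional _ (proj₁ (ends h))
                            in trans (sym (u (fromRel h))) (u (fromRel h′))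
    ; injective = λ h h′ → let (_ , _ , u) = B.bijective _ (proj₂ (ends h))
                           in trans (sym (u (fromRel h))) (u (fromRel h′))
    }
    where
    module B = IsBijection bij
    ends : ∀ {a b} → Rel f a b → a ∈ x × b ∈ y
    ends (p , p∈f , h) with B.⊆-product p p∈f
    ... | a , b , a∈x , b∈y , h′ with opair-injective h (toOPair h′)
    ... | refl , refl = a∈x , b∈y

  -- A member of κ equinumerous with κ would pass its smallness on to κ, whence κ ∈ κ.
  hartogs-initial : ∀ {T κ} → Ord κ → (∀ α → α ∈ κ ↔ (Ord α × Small α T)) → IsInitialOrdinal U κ
  hartogs-initial {T} {κ} oκ κ-mem = ord⇒IsOrdinal oκ , λ α α∈κ → to¬ λ (h , bij) →
    ∈-irrefl (proj₂ (κ-mem κ) (oκ , small α α∈κ h (fromIsBijection bij)))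
    where
    small : ∀ α → α ∈ κ → ∀ h → Bijection h α κ → Small κ T
    small α α∈κ h bij with proj₁ (κ-mem α) α∈κ
    ... | _ , f , tot , inj with relation (∃̇ (relF v3 v0 v1 ∧̇ relF v4 v0 v2)) (h ∷ f ∷ []) κ T
    ... | g , g-rel = g , g-tot , g-inj
      where
      module B = Bijection bij
      g-tot : Total g κ T
      g-tot β β∈κ with B.preimage β∈κ
      ... | a , ha with tot a (B.domain ha)
      ... | t , t∈T , fa = t , t∈T , proj₂ (g-rel β t) (β∈κ , t∈T , a , ha , fa)
      g-inj : Injective g
      g-inj β β′ t k k′ with proj₁ (g-rel β t) k | proj₁ (g-rel β′ t) k′
      ... | _ , _ , a , ha , fa | _ , _ , a′ , ha′ , fa′ with inj a a′ t fa fa′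
      ... | refl = B.functional ha ha′

  -- Large sets of urelements and copies of ordinals among them.

  -- Inclusion of W in D up to a remainder that is an image of a subset of T. For a set W of
  -- urelements and T closed under singletons, the case D = T amounts to W itself being such an
  -- image.
  Covers : Carrier → Carrier → Carrier → Set ℓ
  Covers W D T = ∃ λ f → (∀ d → d ∈ W → d ∈ D ⊎ ∃ λ t → t ∈ T × Rel f d t) × Injective f

  opaque
    -- If T covered B, then κ would be small: send β to its urelement b when b ∈ T, and otherwise to
    -- {t}, where t is a value of the covering relation at b. Urelements and singletons never
    -- collide, so this is injective and gives κ ∈ κ.
    largeUrelementSet : Plenitude U → ∀ {T} → Closed T → ∃ λ κ → ∃ λ B → ∃ λ f →
      Ord κ × (∀ b → b ∈ B → 𝒜 b) × Bijection f B κ × Neg (Covers B T T)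
    largeUrelementSet plenitude {T} (T-trans , T-sing) with hartogs T
    ... | κ , oκ , κ-mem with plenitude κ (hartogs-initial oκ κ-mem)
    ... | B , _ , B-ur , f , bij = κ , B , f , oκ , B-ur , fromIsBijection bij , uncovered
      where
      module B = Bijection (fromIsBijection bij)
      uncovered : Neg (Covers B T T)
      uncovered (f′ , cov , inj)
        with relation (∃̇ (relF v3 v0 v1 ∧̇
               (v0 ∈̇ v5 ∧̇ v2 ≐ v0 ∨̇ ∃∈ v5 (relF v5 v1 v0 ∧̇ unorderedPairF v3 v0 v0))))
               (f ∷ f′ ∷ T ∷ []) κ T
      ... | g , g-rel = ∈-irrefl (proj₂ (κ-mem κ) (oκ , g , g-tot , g-inj))
        where
        g-tot : Total g κ T
        g-tot β β∈κ with B.preimage β∈κ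
        ... | b , h with cov b (B.domain h)
        ... | inj₁ b∈T = b , b∈T , proj₂ (g-rel β b) (β∈κ , b∈T , b , h , inj₁ (b∈T , refl))
        ... | inj₂ (t , t∈T , k) with upair t t
        ... | s , s-pair = s , s∈T , proj₂ (g-rel β s) (β∈κ , s∈T , b , h , inj₂ (t , t∈T , k , s-pair))
          where
          s∈T : s ∈ T
          s∈T = T-sing t s t∈T s-pair
        ur≢singleton : ∀ {b t β} → Rel f b β → UPair b t t → ⊥ {ℓ}
        ur≢singleton h p = inhabited⇒set (proj₂ (p _) (inj₁ refl)) (B-ur _ (B.domain h))
        g-inj : Injective g
        g-inj β β′ s k k′ with proj₁ (g-rel β s) k | proj₁ (g-rel β′ s) k′
        ... | _ , _ , b , h , inj₁ (_ , refl) | _ , _ , b′ , h′ , inj₁ (_ , refl) = B.functional h h′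
        ... | _ , _ , b , h , inj₁ (_ , refl) | _ , _ , b′ , h′ , inj₂ (_ , _ , _ , p) =
              ⊥-elim (ur≢singleton h p)
        ... | _ , _ , b , h , inj₂ (_ , _ , _ , p) | _ , _ , b′ , h′ , inj₁ (_ , refl) =
              ⊥-elim (ur≢singleton h′ p)
        ... | _ , _ , b , h , inj₂ (t , _ , l , p) | _ , _ , b′ , h′ , inj₂ (t′ , _ , l′ , p′)
          with singleton-injective p p′
        ... | refl with inj b b′ t l l′
        ... | refl = B.functional h h′

  -- h(β) is the f-least element of B outside T ∪ h[β]; one exists because β ∈ κ ⊆ T and
  -- T does not cover B.
  module Copy {κ T κ′ B f : Carrier} (oκ : Ord κ) (T-trans : Trans T) (κ∈T : κ ∈ T)
    (oκ′ : Ord κ′) (bij : Bijection f B κ′) (uncovered : Neg (Covers B T T)) where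

    private
      module B = Bijection bij

      params : Vec Carrier 3
      params = B ∷ T ∷ f ∷ []

      Φ : Formula 6
      Φ = (candidateF v3 v4 v1 v2 ∧̇
            ∀̇ (candidateF v4 v5 v2 v0 ⇒̇
              ∀̇ ∀̇ (relF (suc (suc (suc v5))) v5 v1 ⇒̇ relF (suc (suc (suc v5))) v2 v0 ⇒̇ ¬̇ (v0 ∈̇ v1))))
          -- A dummy value that makes the recursion total when no candidate is left; `values` shows
          -- that this does not happen below κ.
          ∨̇ ((¬̇ ∃̇ candidateF v4 v5 v2 v0) ∧̇ v2 ≐ v1)

      Candidate : Carrier → Carrier → Set ℓ
      Candidate r y = y ∈ B × Neg (y ∈ T) × Neg (y ∈ r)

      module R = Recursion params Φ

      opaque
        F-total : ∀ u r → isSet r → ∃ λ y → R.F u r y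
        F-total u r _ with dec (∃̇ candidateF v2 v3 v1 v0) (r ∷ B ∷ T ∷ [])
        ... | inj₂ none = r , inj₂ (none , refl)
        ... | inj₁ (c , cand) with B.image (proj₁ cand)
        ... | ηc , hc with sep (∃̇ (candidateF v3 v4 v2 v0 ∧̇ relF v5 v0 v1)) (r ∷ B ∷ T ∷ f ∷ []) κ′
        ... | S , _ , S-mem with foundation (proj₂ (S-mem ηc) (B.range hc , c , cand , hc))
        ... | η₀ , η₀∈S , η₀-min with proj₁ (S-mem η₀) η₀∈S
        ... | _ , y , y-cand , hy = y , inj₁ (y-cand , least)
          where
          least : ∀ y′ → Candidate r y′ → ∀ η η′ → Rel f y η → Rel f y′ η′ → Neg (η′ ∈ η)
          least y′ cand′ η η′ h h′ η′∈η with B.functional h hy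
          ... | refl = η₀-min η′ (proj₂ (S-mem η′) (B.range h′ , y′ , cand′ , h′)) η′∈η

      opaque
        F-unique : ∀ u r y y′ → R.F u r y → R.F u r y′ → y ≡ y′
        F-unique u r y y′ (inj₂ (_ , refl)) (inj₂ (_ , refl)) = refl
        F-unique u r y y′ (inj₁ (c , _)) (inj₂ (none , _)) = ⊥-elim (none (_ , c))
        F-unique u r y y′ (inj₂ (none , _)) (inj₁ (c , _)) = ⊥-elim (none (_ , c))
        F-unique u r y y′ (inj₁ (c , l)) (inj₁ (c′ , l′)) with B.image (proj₁ c) | B.image (proj₁ c′)
        ... | η , h | η′ , h′ with comparable (ord-∈ oκ′ (B.range h)) (ord-∈ oκ′ (B.range h′))
        ... | inj₁ η∈η′ = ⊥-elim (l′ y c η′ η h′ h η∈η′)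
        ... | inj₂ (inj₁ refl) = B.injective h h′
        ... | inj₂ (inj₂ η′∈η) = ⊥-elim (l y′ c′ η η′ h h′ η′∈η)

      open R.Solution F-total F-unique

      κ-trans : Trans κ
      κ-trans = proj₁ (proj₂ oκ)

      values : ∀ {β y} → β ∈ κ → R.H β y →
               y ∈ B × Neg (y ∈ T) × (∀ γ → γ ∈ β → Neg (R.H γ y))
      values {β} {y} β∈κ h with R.unfold h
      ... | r , _ , a , b , inj₁ ((y∈B , y∉T , y∉r) , _) = y∈B , y∉T , fresh
        where
        fresh : ∀ γ → γ ∈ β → Neg (R.H γ y)
        fresh γ γ∈β k with b γ γ∈β
        ... | z , z∈r , k′ with unique κ-trans (κ-trans β β∈κ γ γ∈β) k k′
        ... | refl = y∉r z∈r
      -- The inverse of h sends each remaining d to some γ ∈ κ ⊆ T. That h is injective is not known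
      -- yet, but a covering relation may be many-valued.
      ... | r , _ , a , b , inj₂ (none , _) with relation (swap R.HF) params B β
      ... | g , g-rel = ⊥-elim (uncovered (g , cov , g-inj))
        where
        cov : ∀ d → d ∈ B → d ∈ T ⊎ ∃ λ t → t ∈ T × Rel g d t
        cov d d∈B with dec-∈ d T
        ... | inj₁ d∈T = inj₁ d∈T
        ... | inj₂ d∉T with dec-∈ d r
        ... | inj₂ d∉r = ⊥-elim (none (d , d∈B , d∉T , d∉r))
        ... | inj₁ d∈r with a d d∈r
        ... | γ , γ∈β , k = inj₂ (γ , T-trans κ κ∈T γ (κ-trans β β∈κ γ γ∈β)
                , proj₂ (g-rel d γ) (d∈B , γ∈β , proj₂ (swap-⊩ R.HF) k))
        g-inj : Injective g
        g-inj d d′ γ k k′ with proj₁ (g-rel d γ) k | proj₁ (g-rel d′ γ) k′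
        ... | _ , γ∈β , l | _ , _ , l′ =
          unique κ-trans (κ-trans β β∈κ γ γ∈β) (proj₁ (swap-⊩ R.HF) l) (proj₁ (swap-⊩ R.HF) l′)

    opaque
      copy : ∃ λ g → (∀ {β} → β ∈ κ → ∃ λ b → Rel g β b) ×
        (∀ {β b} → Rel g β b → b ∈ B × Neg (b ∈ T)) ×
        (∀ {β b b′} → Rel g β b → Rel g β b′ → b ≡ b′) ×
        (∀ {β β′ b} → Rel g β b → Rel g β′ b → β ≡ β′)
      copy with relation R.HF params κ B
      ... | g , g-rel = g , image , range , functional , injective
        where
        image : ∀ {β} → β ∈ κ → ∃ λ b → Rel g β b
        image {β} β∈κ with total κ-trans β∈κ
        ... | b , h = b , proj₂ (g-rel β b) (β∈κ , proj₁ (values β∈κ h) , h)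
        range : ∀ {β b} → Rel g β b → b ∈ B × Neg (b ∈ T)
        range k with proj₁ (g-rel _ _) k
        ... | β∈κ , _ , h with values β∈κ h
        ... | b∈B , b∉T , _ = b∈B , b∉T
        functional : ∀ {β b b′} → Rel g β b → Rel g β b′ → b ≡ b′
        functional k k′ with proj₁ (g-rel _ _) k | proj₁ (g-rel _ _) k′
        ... | β∈κ , _ , h | _ , _ , h′ = unique κ-trans β∈κ h h′
        injective : ∀ {β β′ b} → Rel g β b → Rel g β′ b → β ≡ β′
        injective k k′ with proj₁ (g-rel _ _) k | proj₁ (g-rel _ _) k′
        ... | β∈κ , _ , h | β′∈κ , _ , h′ with comparable (ord-∈ oκ β∈κ) (ord-∈ oκ β′∈κ)
        ... | inj₁ β∈β′ = ⊥-elim (proj₂ (proj₂ (values β′∈κ h′)) _ β∈β′ h)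
        ... | inj₂ (inj₁ e) = e
        ... | inj₂ (inj₂ β′∈β) = ⊥-elim (proj₂ (proj₂ (values β∈κ h)) _ β′∈β h′)

  rel-∅ : ∀ {a b} → Neg (Rel ∅ a b)
  rel-∅ (_ , p∈∅ , _) = ∉∅ p∈∅

  covers-all : ∀ {W D T} → Sub W D → Covers W D T
  covers-all W⊆D = ∅ , (λ d d∈W → inj₁ (W⊆D d d∈W)) , λ _ _ _ h → ⊥-elim (rel-∅ h)

  opaque
    -- If a large set of urelements were contained in the closure T of x, the empty relation would
    -- show that T covers it.
    freshUrelement : Plenitude U → ∀ x → ∃ λ c → 𝒜 c × Neg (c ∈ x)
    freshUrelement plenitude x with closure x
    ... | T , x⊆T , T-closed with largeUrelementSet plenitude T-closed
    ... | _ , B , _ , _ , B-ur , _ , uncovered with dec (∃∈ v0 (¬̇ (v0 ∈̇ v2))) (B ∷ T ∷ [])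
    ... | inj₁ (c , c∈B , c∉T) = c , B-ur c c∈B , λ c∈x → c∉T (x⊆T c c∈x)
    ... | inj₂ none = ⊥-elim (uncovered (covers-all B⊆T))
      where
      B⊆T : Sub B T
      B⊆T b b∈B with dec-∈ b T
      ... | inj₁ b∈T = b∈T
      ... | inj₂ b∉T = ⊥-elim (none (b , b∈B , b∉T))

  -- Transpositions and disjoint swaps of urelements.

  module Transposition {a c : Carrier} (a-ur : 𝒜 a) (c-ur : 𝒜 c) where
    private
      graph : ∃ λ s → ∀ x y → Rel s x y ↔ (x ≡ a × y ≡ c ⊎ x ≡ c × y ≡ a)
      graph with addPair ∅ a c
      ... | s₁ , s₁-rel with addPair s₁ c a
      ... | s , s-rel = s , λ x y →
          (λ h → [ (λ h₁ → [ (λ h₀ → ⊥-elim (rel-∅ h₀)) , inj₁ ]′ (proj₁ (s₁-rel x y) h₁)) , inj₂ ]′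
                   (proj₁ (s-rel x y) h))
        , [ (λ e → proj₂ (s-rel x y) (inj₁ (proj₂ (s₁-rel x y) (inj₂ e))))
          , (λ e → proj₂ (s-rel x y) (inj₂ e)) ]′

      s : Carrier
      s = proj₁ graph

      s-rel : ∀ x y → Rel s x y ↔ (x ≡ a × y ≡ c ⊎ x ≡ c × y ≡ a)
      s-rel = proj₂ graph

      s-sym : ∀ {x y} → Rel s x y → Rel s y x
      s-sym h with proj₁ (s-rel _ _) h
      ... | inj₁ (refl , refl) = proj₂ (s-rel _ _) (inj₂ (refl , refl))
      ... | inj₂ (refl , refl) = proj₂ (s-rel _ _) (inj₁ (refl , refl))

      s-fun : ∀ {x y y′} → Rel s x y → Rel s x y′ → y ≡ y′
      s-fun h h′ with proj₁ (s-rel _ _) h | proj₁ (s-rel _ _) h′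
      ... | inj₁ (refl , refl) | inj₁ (_ , refl) = refl
      ... | inj₁ (refl , refl) | inj₂ (refl , refl) = refl
      ... | inj₂ (refl , refl) | inj₁ (refl , refl) = refl
      ... | inj₂ (refl , refl) | inj₂ (_ , refl) = refl

      s-𝒜 : ∀ {x y} → Rel s x y → 𝒜 x
      s-𝒜 h with proj₁ (s-rel _ _) h
      ... | inj₁ (refl , _) = a-ur
      ... | inj₂ (refl , _) = c-ur

      module E = Extension s s-sym s-fun s-𝒜

    opaque
      transposition : Σ Involution λ τ → let open Involution τ in
        π a ≡ c × (∀ {x} → 𝒜 x → Neg (x ≡ a) → Neg (x ≡ c) → π x ≡ x) ×
        (∀ {t} → Trans t → Neg (a ∈ t) → Neg (c ∈ t) → ∀ x → x ∈ t → π x ≡ x)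
      transposition = E.involution , E.π-rel (proj₂ (s-rel a c) (inj₁ (refl , refl)))
        , (λ x-ur x≢a x≢c → E.π-fixed x-ur λ y h →
             [ (λ (e , _) → x≢a e) , (λ (e , _) → x≢c e) ]′ (proj₁ (s-rel _ y) h))
        , λ t-trans a∉t c∉t → E.fixes t-trans λ x x∈t _ y h →
             [ (λ { (refl , _) → a∉t x∈t }) , (λ { (refl , _) → c∉t x∈t }) ]′ (proj₁ (s-rel x y) h)

  open Transposition using (transposition)

  -- Room for one more element in the remainder: each old value t is replaced by {t}, which frees ∅
  -- for a.
  covers-transposed : ∀ {W T a D D′} → Closed T → ∅ ∈ T → Covers W D T →
    (∀ d → d ∈ W → Neg (d ≡ a) → d ∈ D → d ∈ D′) → Covers W D′ T
  covers-transposed {W} {T} {a} {D} {D′} (_ , T-sing) ∅∈T (f , cov , inj) move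
    with relation (∃∈ v3 (relF v3 v1 v0 ∧̇ unorderedPairF v2 v0 v0)) (f ∷ T ∷ []) W T
  ... | g₀ , g₀-rel with addPair g₀ a ∅
  ... | g , g-rel = g , g-cov , g-inj
    where
    g-cov : ∀ d → d ∈ W → d ∈ D′ ⊎ ∃ λ t → t ∈ T × Rel g d t
    g-cov d d∈W with dec-≡ d a
    ... | inj₁ refl = inj₂ (∅ , ∅∈T , proj₂ (g-rel d ∅) (inj₂ (refl , refl)))
    ... | inj₂ d≢a with cov d d∈W
    ... | inj₁ d∈D = inj₁ (move d d∈W d≢a d∈D)
    ... | inj₂ (t , t∈T , h) with upair t t
    ... | u , u-pair = inj₂ (u , u∈T , proj₂ (g-rel d u) (inj₁ (proj₂ (g₀-rel d u) (d∈W , u∈T , t , t∈T , h , u-pair))))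
      where
      u∈T : u ∈ T
      u∈T = T-sing t u t∈T u-pair
    nonempty : ∀ {d} → Neg (Rel g₀ d ∅)
    nonempty h with proj₁ (g₀-rel _ _) h
    ... | _ , _ , t , _ , _ , p = ∉∅ (proj₂ (p t) (inj₁ refl))
    g-inj : Injective g
    g-inj d d′ u k k′ with proj₁ (g-rel d u) k | proj₁ (g-rel d′ u) k′
    ... | inj₂ (refl , _) | inj₂ (refl , _) = refl
    ... | inj₂ (_ , refl) | inj₁ h = ⊥-elim (nonempty h)
    ... | inj₁ h | inj₂ (_ , refl) = ⊥-elim (nonempty h)
    ... | inj₁ h | inj₁ h′ with proj₁ (g₀-rel d u) h | proj₁ (g₀-rel d′ u) h′
    ... | _ , _ , t , _ , l , p | _ , _ , t′ , _ , l′ , p′ with singleton-injective p p′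
    ... | refl = inj d d′ t l l′

  opaque
    -- The copy of κ is taken among urelements outside a closed T′ that contains T, B and κ, so it
    -- is disjoint from T and from B; κ ∈ T′ is what `Copy` requires. Only elements of B outside T
    -- are exchanged, hence no urelement of T moves.
    disjointSwap : Plenitude U → ∀ {κ B f T} → Ord κ → (∀ b → b ∈ B → 𝒜 b) → Bijection f B κ →
      Trans T → Σ Involution λ τ → let open Involution τ in
      (∀ b → b ∈ B → Neg (b ∈ T) → Neg (π b ∈ B)) ×
      (∀ {t} → Trans t → (∀ a → a ∈ t → 𝒜 a → a ∈ T) → ∀ x → x ∈ t → π x ≡ x)
    disjointSwap plenitude {κ} {B} {f} {T} oκ B-ur bij T-trans with upair B κ
    ... | q , q-pair with closure₂ T q
    ... | T′ , T∈T′ , q∈T′ , T′-closed@(T′-trans , _) with largeUrelementSet plenitude T′-closed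
    ... | κ′ , B′ , f′ , oκ′ , B′-ur , bij′ , uncovered
      with Copy.copy oκ T′-trans (T′-trans q q∈T′ κ (proj₂ (q-pair κ) (inj₂ refl))) oκ′ bij′ uncovered
    ... | g , g-image , g-range , g-fun , g-inj with binaryUnion B B′
    ... | BB , _ , BB-mem
      with relation (¬̇ (v0 ∈̇ v4) ∧̇ ∃̇ (relF v3 v1 v0 ∧̇ relF v4 v0 v2)
                     ∨̇ ¬̇ (v1 ∈̇ v4) ∧̇ ∃̇ (relF v3 v2 v0 ∧̇ relF v4 v0 v1)) (f ∷ g ∷ T ∷ []) BB BB
    ... | s , s-rel = E.involution , disjoint , fixed
      where
      module B = Bijection bij
      Pair : Carrier → Carrier → Set ℓ
      Pair a b = Neg (a ∈ T) × ∃ λ β → Rel f a β × Rel g β b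
      s⇒ : ∀ {a b} → Rel s a b → Pair a b ⊎ Pair b a
      s⇒ h = proj₂ (proj₂ (proj₁ (s-rel _ _) h))
      ⇒s : ∀ {a b} → Pair a b → Rel s a b
      ⇒s k@(_ , β , h , h′) = proj₂ (s-rel _ _)
        (proj₂ (BB-mem _) (inj₁ (B.domain h)) , proj₂ (BB-mem _) (inj₂ (proj₁ (g-range h′))) , inj₁ k)
      B⊆T′ : Sub B T′
      B⊆T′ = T′-trans B (T′-trans q q∈T′ B (proj₂ (q-pair B) (inj₁ refl)))
      off : ∀ {a b c} → Pair a b → Pair b c → ⊥ {ℓ}
      off (_ , _ , _ , h) (_ , _ , k , _) = proj₂ (g-range h) (B⊆T′ _ (B.domain k))
      s-sym : ∀ {a b} → Rel s a b → Rel s b a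
      s-sym h with proj₁ (s-rel _ _) h
      ... | a∈ , b∈ , inj₁ k = proj₂ (s-rel _ _) (b∈ , a∈ , inj₂ k)
      ... | a∈ , b∈ , inj₂ k = proj₂ (s-rel _ _) (b∈ , a∈ , inj₁ k)
      s-fun : ∀ {a b b′} → Rel s a b → Rel s a b′ → b ≡ b′
      s-fun h h′ with s⇒ h | s⇒ h′
      ... | inj₁ k | inj₂ k′ = ⊥-elim (off k′ k)
      ... | inj₂ k | inj₁ k′ = ⊥-elim (off k k′)
      ... | inj₁ (_ , β , k , l) | inj₁ (_ , β′ , k′ , l′) with B.functional k k′
      ... | refl = g-fun l l′
      s-fun h h′ | inj₂ (_ , β , k , l) | inj₂ (_ , β′ , k′ , l′) with g-inj l l′
      ... | refl = B.injective k k′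
      s-𝒜 : ∀ {a b} → Rel s a b → 𝒜 a
      s-𝒜 h with s⇒ h
      ... | inj₁ (_ , _ , k , _) = B-ur _ (B.domain k)
      ... | inj₂ (_ , _ , _ , l) = B′-ur _ (proj₁ (g-range l))
      module E = Extension s s-sym s-fun s-𝒜
      disjoint : ∀ b → b ∈ B → Neg (b ∈ T) → Neg (E.π b ∈ B)
      disjoint b b∈B b∉T πb∈B with B.image b∈B
      ... | β , h with g-image (B.range h)
      ... | c , k = proj₂ (g-range k) (B⊆T′ c (subst (_∈ B) (E.π-rel (⇒s (b∉T , β , h , k))) πb∈B))
      fixed : ∀ {t} → Trans t → (∀ a → a ∈ t → 𝒜 a → a ∈ T) → ∀ x → x ∈ t → E.π x ≡ x
      fixed t-trans t-ur = E.fixes t-trans λ a a∈t a-ur b h →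
        [ (λ (a∉T , _) → a∉T (t-ur a a∈t a-ur))
        , (λ (_ , _ , _ , l) → proj₂ (g-range l) (T′-trans T T∈T′ a (t-ur a a∈t a-ur))) ]′ (s⇒ h)

  -- Equivariance of ε and the contradiction.

  equivariant : ∀ {ε : Class U → Carrier} (φ : Formula₂ 2 1) (P : Class U) →
    (∀ X y → (ε X ≡ y) ⇔ (_,_⊨₂_ U (X ∷ P ∷ []) (y ∷ []) φ)) →
    (τ : Involution) → let open Involution τ in πᶜ P ≡ P → ∀ X → ε (πᶜ X) ≡ π (ε X)
  equivariant {ε} φ P def τ fixP X = Equivalence.from (def (πᶜ X) (π (ε X)))
    (subst (λ Q → _,_⊨₂_ U (πᶜ X ∷ Q ∷ []) (π (ε X) ∷ []) φ) fixP
      (proj₁ (invariant₂ φ (X ∷ P ∷ []) (ε X ∷ [])) (Equivalence.to (def X (ε X)) refl)))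
    where open Involution τ

  module Refutation (plenitude : Plenitude U) (ε : Class U → Carrier)
    (φ : Formula₂ 2 1) (ψ : Formula 2) (p : Carrier)
    (def : ∀ X y → (ε X ≡ y) ⇔ (_,_⊨₂_ U (X ∷ ⟨ ψ , p ⟩ ∷ []) (y ∷ []) φ)) (law : BasicLawV U ε)
    {T κ B f W z : Carrier} (p∈T : p ∈ T) (∅∈T : ∅ ∈ T) (T-closed : Closed T)
    (oκ : Ord κ) (B-ur : ∀ b → b ∈ B → 𝒜 b) (bij : Bijection f B κ) (uncovered : Neg (Covers B T T))
    (W-mem : ∀ b → b ∈ W ↔ (b ∈ B × Neg (b ∈ T))) (z-pair : OPair z W T) where

    private
      T-trans : Trans T
      T-trans = proj₁ T-closed

      infix 4 _∈̂_
      _∈̂_ : Carrier → Class U → Set ℓ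
      _∈̂_ = _∈ᶜ_ U

      -- X = {D : W ∖ D is an image of a subset of T}; a class has one parameter, here z = (W , T).
      X : Class U
      X = ⟨ ∃̇ ∃̇ (orderedPairF v3 v1 v0 ∧̇ coversF v1 v2 v0) , z ⟩

      X-elim : ∀ {D} → D ∈̂ X → Covers W D T
      X-elim (W′ , T′ , h , k) with opair-injective z-pair h
      ... | refl , refl = k

      X-intro : ∀ {D} → Covers W D T → D ∈̂ X
      X-intro k = W , T , z-pair , k

      e : Carrier
      e = ε X

      transported : (τ : Involution) → let open Involution τ in
        (∀ x → x ∈ T → π x ≡ x) → ε (πᶜ X) ≡ π e
      transported τ fix = equivariant φ ⟨ ψ , p ⟩ def τ (cong ⟨ ψ ,_⟩ (fix p p∈T)) X

      opaque
        -- Inside W at most a is moved, because c ∉ W. So passing from D to π D adds at most a to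
        -- the part of W left out, and `covers-transposed` absorbs it; involutivity gives the
        -- converse.
        fixedByTransposition : ∀ {a c} → Neg (c ∈ W) → (τ : Involution) → let open Involution τ in
          (∀ {x} → 𝒜 x → Neg (x ≡ a) → Neg (x ≡ c) → π x ≡ x) → (∀ x → x ∈ T → π x ≡ x) → π e ≡ e
        fixedByTransposition {a} {c} c∉W τ fixUr fixT =
          trans (sym (transported τ fixT)) (Equivalence.from (law (πᶜ X) X) same)
          where
          open Involution τ
          moves : ∀ D → D ∈̂ X → π D ∈̂ X
          moves D D∈X = X-intro (covers-transposed {a = a} T-closed ∅∈T (X-elim D∈X) λ d d∈W d≢a d∈D →
            subst (_∈ π D)
              (fixUr (B-ur d (proj₁ (proj₁ (W-mem d) d∈W))) d≢a (λ { refl → c∉W d∈W })) (π-∈ d∈D))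
          same : ∀ x → (x ∈̂ πᶜ X) ⇔ (x ∈̂ X)
          same x = mk⇔
            (λ h → subst (_∈̂ X) (involutive x)
              (moves (π x) (proj₂ (invariantᶜ (π x) X) (subst (_∈̂ πᶜ X) (sym (involutive x)) h))))
            (λ h → subst (_∈̂ πᶜ X) (involutive x) (proj₁ (invariantᶜ (π x) X) (moves x h)))

      opaque
        -- One fresh c suffices: it is chosen outside T, W and also t, whereas the transposition
        -- fixes `e`, so it preserves t and carries a ∈ t to c.
        support : ∃ λ t → e ∈ t × Trans t × (∀ a → a ∈ t → 𝒜 a → a ∈ T)
        support with minimalTransitive e
        ... | t , e∈t , t-trans , t-min = t , e∈t , t-trans , inT
          where
          -- π t is transitive and contains π e = e, so minimality gives t ⊆ π t; since π is an
          -- involution, π maps t into t.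
          stable : (τ : Involution) → let open Involution τ in π e ≡ e → ∀ x → x ∈ t → π x ∈ t
          stable τ πe≡e x x∈t = π-∈⁻¹ (subst (_∈ π t) (sym (involutive x))
              (t-min (π t) (subst (_∈ π t) πe≡e (π-∈ e∈t)) πt-trans x x∈t))
            where
            open Involution τ
            πt-trans : Trans (π t)
            πt-trans y y∈πt x x∈y = subst (_∈ π t) (involutive x)
              (π-∈ (t-trans (π y) (π-∈⁻¹ (subst (_∈ π t) (sym (involutive y)) y∈πt)) (π x) (π-∈ x∈y)))
          inT : ∀ a → a ∈ t → 𝒜 a → a ∈ T
          inT a a∈t a-ur with dec-∈ a T
          ... | inj₁ a∈T = a∈T
          ... | inj₂ a∉T with binaryUnion T W
          ... | TW , _ , TW-mem with binaryUnion TW t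
          ... | S , _ , S-mem with freshUrelement plenitude S
          ... | c , c-ur , c∉S with transposition a-ur c-ur
          ... | τ , πa≡c , fixUr , fixTrans = ⊥-elim (c∉S (proj₂ (S-mem c) (inj₂
              (subst (_∈ t) πa≡c (stable τ (fixedByTransposition c∉W τ fixUr (fixTrans T-trans a∉T c∉T)) a a∈t)))))
            where
            c∉T : Neg (c ∈ T)
            c∉T h = c∉S (proj₂ (S-mem c) (inj₁ (proj₂ (TW-mem c) (inj₁ h))))
            c∉W : Neg (c ∈ W)
            c∉W h = c∉S (proj₂ (S-mem c) (inj₁ (proj₂ (TW-mem c) (inj₂ h))))

      opaque
        -- Every element of B is in T or in W. If D misses W, a relation covering W up to D would
        -- also cover B up to T.
        uncoveredByDisjoint : ∀ {D} → (∀ b → b ∈ W → Neg (b ∈ D)) → Neg (Covers W D T)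
        uncoveredByDisjoint {D} disjoint (g , cov , g-inj) = uncovered (g , cov′ , g-inj)
          where
          cov′ : ∀ b → b ∈ B → b ∈ T ⊎ ∃ λ t → t ∈ T × Rel g b t
          cov′ b b∈B with dec-∈ b T
          ... | inj₁ b∈T = inj₁ b∈T
          ... | inj₂ b∉T with cov b (proj₂ (W-mem b) (b∈B , b∉T))
          ... | inj₂ h = inj₂ h
          ... | inj₁ b∈D = ⊥-elim (disjoint b (proj₂ (W-mem b) (b∈B , b∉T)) b∈D)

    opaque
      contradiction : ⊥ {ℓ}
      contradiction with support | disjointSwap plenitude oκ B-ur bij T-trans
      ... | t , e∈t , t-trans , t-ur | τ , disjoint , fixed = uncoveredByDisjoint disjoint′ πW∈X
        where
        open Involution τ
        same : ∀ x → (x ∈̂ X) ⇔ (x ∈̂ πᶜ X)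
        same = Equivalence.to (law X (πᶜ X)) (sym
          (trans (transported τ (fixed T-trans λ a a∈T _ → a∈T)) (fixed t-trans t-ur e e∈t)))
        πW∈X : Covers W (π W) T
        πW∈X = X-elim (proj₂ (invariantᶜ (π W) X) (subst (_∈̂ πᶜ X) (sym (involutive W))
          (Equivalence.to (same W) (X-intro (covers-all λ _ h → h)))))
        disjoint′ : ∀ b → b ∈ W → Neg (b ∈ π W)
        disjoint′ b b∈W b∈πW with proj₁ (W-mem b) b∈W
        ... | b∈B , b∉T = disjoint b b∈B b∉T (proj₁ (proj₁ (W-mem (π b))
                (π-∈⁻¹ (subst (_∈ π W) (sym (involutive b)) b∈πW))))

  noBasicLawV : Plenitude U →
    ¬ (∃ λ (ε : Class U → Carrier) → ParametricallyDefinable U ε × BasicLawV U ε)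
  -- p ∈ T lets automorphisms that fix T fix the parameter; ∅ ∈ T supplies the spare value for
  -- `covers-transposed`.
  noBasicLawV plenitude (ε , (φ , ⟨ ψ , p ⟩ , def) , law) with closure₂ p ∅
  ... | T , p∈T , ∅∈T , T-closed with largeUrelementSet plenitude T-closed
  ... | κ , B , f , oκ , B-ur , bij , uncovered with sep (¬̇ (v0 ∈̇ v1)) (T ∷ []) B
  ... | W , _ , W-mem with opair W T
  ... | z , z-pair = ⊥-elim (Refutation.contradiction plenitude ε φ ψ p def law
          p∈T ∅∈T T-closed oκ B-ur bij uncovered W-mem z-pair)

theorem5 : ∀ {ℓ} (U : Structure ℓ) → IsModelOfZFUR U → Plenitude U →
    ¬ (∃ λ (ε : Class U → Structure.Carrier U) →
    ParametricallyDefinable U ε × BasicLawV U ε)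
theorem5 U M plenitude = Model.noBasicLawV U M plenitude
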